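{- Let $m\geq 1$ be an integer and let $n=2m$. Let $A$ be the adjacency matrix of the $n$-cube graph $Q_n$ (with respect to any ordering of the vertices). Then $A$ is integrally equivalent to a $2^n\times 2^n$ diagonal matrix with exactly $\binom{n}{m}$ diagonal entries equal to zero, whose nonzero diagonal entries are the integers $k=1,2,\ldots,m$, in which the multiplicity of $k$ is $2\binom{n}{m-k}$.
   Context: The $n$-cube graph $Q_n$ has vertex set $\{0,1\}^n$, with two vertices joined by an edge if and only if the $n$-tuples differ in exactly one component. Two integral matrices $X$ and $Y$ of the same size are integrally equivalent if there exist unimodular integral matrices $U$ and $V$ (i.e. invertible over $\mathbb{Z}$) such that $UXV=Y$. -}

module Defs where

open import Data.Bool.Base using (if_then_else_)
open import Data.Fin.Base using (Fin)
import Data.Fin.Properties as Fin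
open import Data.Integer.Base using (ℤ; 0ℤ; 1ℤ; _*_)
import Data.Integer.Properties as ℤ
open import Data.Nat.Base using (ℕ)
open import Data.Product.Base using (_×_; _,_; ∃-syntax)
open import Data.Product using (∃!)
open import Data.Vec.Base using (Vec; lookup; count; tabulate)
open import Data.Vec.Functional using (Vector; replicate)
open import Function.Base using (_∘_)
open import Function.Bundles using (_↔_; Inverse)
open import Relation.Binary.Definitions using (Decidable; Symmetric)
open import Relation.Binary.PropositionalEquality using (_≡_; _≢_; refl; sym)
open import Relation.Nullary.Decidable using (Dec; does; map′; ¬?; _×-dec_; _→-dec_)
open import Relation.Nullary.Negation using (¬_)

Matrix : ℕ → ℕ → Set
Matrix m n = Vector (Vector ℤ n) m

-- Entrywise, as there is no function extensionality.
infix 4 _≈ᴹ_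
_≈ᴹ_ : ∀ {m n} → Matrix m n → Matrix m n → Set
X ≈ᴹ Y = ∀ i j → X i j ≡ Y i j

infixl 7 _*ᴹ_
_*ᴹ_ : ∀ {m n p} → Matrix m n → Matrix n p → Matrix m p
_*ᴹ_ {n = n} X Y i k = ∑[ j < n ] (X i j * Y j k)
  where open import Algebra.Properties.CommutativeMonoid.Sum ℤ.+-0-commutativeMonoid

diagonal : ∀ {n} → Vector ℤ n → Matrix n n
diagonal d i j = if does (i Fin.≟ j) then d i else 0ℤ

identity : ∀ n → Matrix n n
identity n = diagonal (replicate n 1ℤ)

Unimodular : ∀ {n} → Matrix n n → Set
Unimodular {n} U = ∃[ W ] (U *ᴹ W ≈ᴹ identity n × W *ᴹ U ≈ᴹ identity n)

IntegrallyEquivalent : ∀ {m n} → Matrix m n → Matrix m n → Set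
IntegrallyEquivalent X Y =
  ∃[ U ] ∃[ V ] (Unimodular U × Unimodular V × U *ᴹ X *ᴹ V ≈ᴹ Y)

multiplicity : ∀ {n} → ℤ → Vector ℤ n → ℕ
multiplicity z d = count (ℤ._≟ z) (tabulate d)

record Graph : Set₁ where
  field
    Vertex      : Set
    Adjacent    : Vertex → Vertex → Set
    adjacent?   : Decidable Adjacent
    symmetric   : Symmetric Adjacent
    irreflexive : ∀ {v} → ¬ Adjacent v v

-- The bijection is the chosen ordering of the vertices.
adjacencyMatrix : ∀ (G : Graph) {N} → Fin N ↔ Graph.Vertex G → Matrix N N
adjacencyMatrix G ordering i j = if does (adjacent? (to i) (to j)) then 1ℤ else 0ℤ
  where
  open Graph G
  open Inverse ordering using (to)

module _ {n : ℕ} where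

  DifferAt : Vec (Fin 2) n → Vec (Fin 2) n → Fin n → Set
  DifferAt u v i = lookup u i ≢ lookup v i

  differAt? : ∀ u v i → Dec (DifferAt u v i)
  differAt? u v i = ¬? (lookup u i Fin.≟ lookup v i)

  DifferInExactlyOne : Vec (Fin 2) n → Vec (Fin 2) n → Set
  DifferInExactlyOne u v = ∃! _≡_ (DifferAt u v)

  differInExactlyOne? : Decidable DifferInExactlyOne
  differInExactlyOne? u v = Fin.any? λ i →
    differAt? u v i ×-dec
    map′ (λ f {j} → f j) (λ f j → f {j})
         (Fin.all? λ j → differAt? u v j →-dec (i Fin.≟ j))

cube : ℕ → Graph
cube n = record
  { Vertex      = Vec (Fin 2) n
  ; Adjacent    = DifferInExactlyOne
  ; adjacent?   = differInExactlyOne?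
  ; symmetric   = λ (i , u≢v , unique) → i , u≢v ∘ sym , λ v≢u → unique (v≢u ∘ sym)
  ; irreflexive = λ (i , v≢v , _) → v≢v refl
  }

{-# OPTIONS --safe #-}

-- In the basis of monomials t_S the adjacency operator of Q_n, n = 2m, sends t_S to
-- 2 (m - |S|) t_S + ∑_{i ∈ S} t_{S - i}. Its diagonal vanishes in degree m, so it is the direct sum
-- of a map X from degrees ≤ m to degrees < m and a map from degrees > m to degrees ≥ m; signed
-- complementation of subsets turns the latter into -Xᵀ. The diagonal operator t_S ↦ (m - |S|) t_S
-- splits in the same way, so it is enough to compare the two maps X.
-- For a ballot sequence T (no initial segment has more members than non-members) the sums of the
-- coefficients of degree l over all S ⊇ T, l = |T|, |T| + 1, …, form a polynomial f of degree at
-- most r = m - |T|. These polynomials are coordinates on the degrees ≤ m, and on each of them X acts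
-- by f ↦ 2 r f + (1 - 2t) f′, which sends (1 - 2t)ᵃ tᵈ with a + d = r to d (1 - 2t)ᵃ tᵈ⁻¹.

module Submission where

open import Defs
open import Data.Fin.Base using (Fin)
open import Data.Integer.Base using (0ℤ; +_)
open import Data.Nat.Base using (ℕ; _*_; _^_; _∸_; _≤_)
open import Data.Nat.Combinatorics using (_C_)
open import Data.Product.Base using (_×_; ∃-syntax)
open import Data.Vec.Base using (Vec)
open import Function.Bundles using (_↔_)
open import Relation.Binary.PropositionalEquality using (_≡_; _≢_)

import Algebra.Properties.Semiring.Sum as SemiringSum
open import Data.Bool.Base using (Bool; true; false; not; if_then_else_)
import Data.Bool.Properties as Bool
open import Data.Fin.Base using (zero; suc)
import Data.Fin.Properties as Fin
open import Data.Integer.Base as ℤ using (ℤ; 1ℤ; -1ℤ; _+_; _-_; -[1+_]; pred)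
import Data.Integer.Properties as ℤ
open import Data.Integer.Tactic.RingSolver using (solve-∀)
open import Data.Nat.Base as ℕ using (zero; suc; ∣_-_∣; z≤n; s≤s; _<ᵇ_; _≡ᵇ_)
open import Data.Nat.Combinatorics using (nCk+nC[k+1]≡[n+1]C[k+1]; nCk≡nC[n∸k]; k>n⇒nCk≡0)
import Data.Nat.Properties as ℕ
open import Data.Product.Base using (_,_; proj₁; proj₂)
open import Data.Sum.Base using (_⊎_; inj₁; inj₂)
open import Data.Unit.Base using (⊤; tt)
open import Data.Vec.Base using ([]; _∷_; lookup)
import Data.Vec.Properties as Vec
import Function.Base as Fun
open import Function.Bundles using (Inverse; mk⇔)
open import Relation.Binary.PropositionalEquality
  using (refl; sym; trans; cong; cong₂; subst; module ≡-Reasoning)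
open import Relation.Nullary.Decidable using (Dec; does; does-⇔; dec-true; dec-false; decidable-stable)
open import Relation.Nullary.Negation using (contradiction)
open SemiringSum ℤ.+-*-semiring using (sum; sum-syntax; sum-cong-≗; ∑-distrib-+; *-distribˡ-sum)
open ≡-Reasoning

-- Linear algebra over ℤ

-- The characters diagonalise the adjacency operator only over ℚ: the determinant of their matrix
-- is, up to sign, a power of 2. So source and target need different bases. For a single polynomial
-- this is possible because t and 1 - 2t, homogenised, are a unimodular substitution in binary
-- forms; hence the products (1 - 2t)ᵃ tᵈ with a + d fixed are a ℤ-basis. The operators carry
-- parameters ε and b, equal to 1 and 2 for the cube and to 0 and 1 for the diagonal, so that both
-- pass through the same splitting and the same coordinates. The coordinates have the right number:
-- C(n,s) - C(n,s-1) ballot sequences have s members, and these numbers sum over s ≤ l to C(n,l)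
-- when 2 l ≤ n. That they form a basis is shown by induction on n, where the bound on the degrees
-- is not inherited by smaller n. The induction therefore admits all degrees and cuts the polynomial
-- of T to its first n + 1 - 2 |T| coefficients, the length of the symmetric chain that starts at T.
-- Within the bound nothing is cut off.

data Ob : Set where
  𝟘 𝟙 : Ob
  _⊕_ : Ob → Ob → Ob

infixr 6 _⊕_

private variable
  A B A₁ B₁ A₂ B₂ A₃ B₃ : Ob

-- Free modules keep the bracketing of their summands, so that block decompositions are pairs by
-- definition and bases need no numbering.
⟦_⟧ : Ob → Set
⟦ 𝟘 ⟧     = ⊤
⟦ 𝟙 ⟧     = ℤ
⟦ A ⊕ B ⟧ = ⟦ A ⟧ × ⟦ B ⟧

infixl 6 _+ᵛ_
infixr 7 _·_

0ᵛ : ∀ {A} → ⟦ A ⟧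
0ᵛ {𝟘}     = tt
0ᵛ {𝟙}     = 0ℤ
0ᵛ {A ⊕ B} = 0ᵛ , 0ᵛ

_+ᵛ_ : ∀ {A} → ⟦ A ⟧ → ⟦ A ⟧ → ⟦ A ⟧
_+ᵛ_ {𝟘}     _       _         = tt
_+ᵛ_ {𝟙}     x       y         = x + y
_+ᵛ_ {A ⊕ B} (x , y) (x′ , y′) = x +ᵛ x′ , y +ᵛ y′

_·_ : ∀ {A} → ℤ → ⟦ A ⟧ → ⟦ A ⟧
_·_ {𝟘}     c _       = tt
_·_ {𝟙}     c x       = c ℤ.* x
_·_ {A ⊕ B} c (x , y) = c · x , c · y

⟨_∣_⟩ : ∀ {A} → ⟦ A ⟧ → ⟦ A ⟧ → ℤ
⟨_∣_⟩ {𝟘}     _       _         = 0ℤ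
⟨_∣_⟩ {𝟙}     x       y         = x ℤ.* y
⟨_∣_⟩ {A ⊕ B} (x , y) (x′ , y′) = ⟨ x ∣ x′ ⟩ + ⟨ y ∣ y′ ⟩

+ᵛ-identityˡ : ∀ {A} (x : ⟦ A ⟧) → 0ᵛ +ᵛ x ≡ x
+ᵛ-identityˡ {𝟘}     _       = refl
+ᵛ-identityˡ {𝟙}     x       = ℤ.+-identityˡ x
+ᵛ-identityˡ {A ⊕ B} (x , y) = cong₂ _,_ (+ᵛ-identityˡ x) (+ᵛ-identityˡ y)

+ᵛ-identityʳ : ∀ {A} (x : ⟦ A ⟧) → x +ᵛ 0ᵛ ≡ x
+ᵛ-identityʳ {𝟘}     _       = refl
+ᵛ-identityʳ {𝟙}     x       = ℤ.+-identityʳ x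
+ᵛ-identityʳ {A ⊕ B} (x , y) = cong₂ _,_ (+ᵛ-identityʳ x) (+ᵛ-identityʳ y)

+ᵛ-comm : ∀ {A} (x y : ⟦ A ⟧) → x +ᵛ y ≡ y +ᵛ x
+ᵛ-comm {𝟘}     _       _         = refl
+ᵛ-comm {𝟙}     x       y         = ℤ.+-comm x y
+ᵛ-comm {A ⊕ B} (x , y) (x′ , y′) = cong₂ _,_ (+ᵛ-comm x x′) (+ᵛ-comm y y′)

+ᵛ-assoc : ∀ {A} (x y z : ⟦ A ⟧) → (x +ᵛ y) +ᵛ z ≡ x +ᵛ (y +ᵛ z)
+ᵛ-assoc {𝟘}     _       _       _       = refl
+ᵛ-assoc {𝟙}     x       y       z       = ℤ.+-assoc x y z
+ᵛ-assoc {A ⊕ B} (x , y) (u , v) (w , z) = cong₂ _,_ (+ᵛ-assoc x u w) (+ᵛ-assoc y v z)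

+ᵛ-interchange : ∀ {A} (x y z w : ⟦ A ⟧) → (x +ᵛ y) +ᵛ (z +ᵛ w) ≡ (x +ᵛ z) +ᵛ (y +ᵛ w)
+ᵛ-interchange {𝟘}     _ _ _ _ = refl
+ᵛ-interchange {𝟙}     x y z w = interchange x y z w
  where
  interchange : ∀ x y z w → (x + y) + (z + w) ≡ (x + z) + (y + w)
  interchange = solve-∀
+ᵛ-interchange {A ⊕ B} (x , x′) (y , y′) (z , z′) (w , w′) =
  cong₂ _,_ (+ᵛ-interchange x y z w) (+ᵛ-interchange x′ y′ z′ w′)

·-identityˡ : ∀ {A} (x : ⟦ A ⟧) → 1ℤ · x ≡ x
·-identityˡ {𝟘}     _       = refl
·-identityˡ {𝟙}     x       = ℤ.*-identityˡ x
·-identityˡ {A ⊕ B} (x , y) = cong₂ _,_ (·-identityˡ x) (·-identityˡ y)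

·-zeroˡ : ∀ {A} (x : ⟦ A ⟧) → 0ℤ · x ≡ 0ᵛ
·-zeroˡ {𝟘}     _       = refl
·-zeroˡ {𝟙}     x       = ℤ.*-zeroˡ x
·-zeroˡ {A ⊕ B} (x , y) = cong₂ _,_ (·-zeroˡ x) (·-zeroˡ y)

·-assoc : ∀ {A} c d (x : ⟦ A ⟧) → (c ℤ.* d) · x ≡ c · d · x
·-assoc {𝟘}     _ _ _       = refl
·-assoc {𝟙}     c d x       = ℤ.*-assoc c d x
·-assoc {A ⊕ B} c d (x , y) = cong₂ _,_ (·-assoc c d x) (·-assoc c d y)

·-distribˡ : ∀ {A} c (x y : ⟦ A ⟧) → c · (x +ᵛ y) ≡ c · x +ᵛ c · y
·-distribˡ {𝟘}     _ _       _         = refl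
·-distribˡ {𝟙}     c x       y         = ℤ.*-distribˡ-+ c x y
·-distribˡ {A ⊕ B} c (x , y) (x′ , y′) = cong₂ _,_ (·-distribˡ c x x′) (·-distribˡ c y y′)

·-distribʳ : ∀ {A} (x : ⟦ A ⟧) c d → (c + d) · x ≡ c · x +ᵛ d · x
·-distribʳ {𝟘}     _       _ _ = refl
·-distribʳ {𝟙}     x       c d = ℤ.*-distribʳ-+ x c d
·-distribʳ {A ⊕ B} (x , y) c d = cong₂ _,_ (·-distribʳ x c d) (·-distribʳ y c d)

·-zeroʳ : ∀ {A} c → c · 0ᵛ {A} ≡ 0ᵛ
·-zeroʳ {𝟘}     _ = refl
·-zeroʳ {𝟙}     c = ℤ.*-zeroʳ c
·-zeroʳ {A ⊕ B} c = cong₂ _,_ (·-zeroʳ c) (·-zeroʳ c)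

+ᵛ-inverseʳ : ∀ {A} (x : ⟦ A ⟧) → x +ᵛ -1ℤ · x ≡ 0ᵛ
+ᵛ-inverseʳ x = begin
  x +ᵛ -1ℤ · x       ≡⟨ cong (_+ᵛ -1ℤ · x) (sym (·-identityˡ x)) ⟩
  1ℤ · x +ᵛ -1ℤ · x  ≡⟨ ·-distribʳ x 1ℤ -1ℤ ⟨
  0ℤ · x             ≡⟨ ·-zeroˡ x ⟩
  0ᵛ                 ∎

x+y-y : ∀ {A} (x y : ⟦ A ⟧) → (x +ᵛ y) +ᵛ -1ℤ · y ≡ x
x+y-y x y = trans (+ᵛ-assoc x y _) (trans (cong (x +ᵛ_) (+ᵛ-inverseʳ y)) (+ᵛ-identityʳ x))

x-y+y : ∀ {A} (x y : ⟦ A ⟧) → (x +ᵛ -1ℤ · y) +ᵛ y ≡ x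
x-y+y x y = trans (+ᵛ-assoc x _ y)
  (trans (cong (x +ᵛ_) (trans (+ᵛ-comm _ y) (+ᵛ-inverseʳ y))) (+ᵛ-identityʳ x))

⟨⟩-comm : ∀ {A} (x y : ⟦ A ⟧) → ⟨ x ∣ y ⟩ ≡ ⟨ y ∣ x ⟩
⟨⟩-comm {𝟘}     _       _         = refl
⟨⟩-comm {𝟙}     x       y         = ℤ.*-comm x y
⟨⟩-comm {A ⊕ B} (x , y) (x′ , y′) = cong₂ _+_ (⟨⟩-comm x x′) (⟨⟩-comm y y′)

⟨⟩-+ˡ : ∀ {A} (x y z : ⟦ A ⟧) → ⟨ x +ᵛ y ∣ z ⟩ ≡ ⟨ x ∣ z ⟩ + ⟨ y ∣ z ⟩
⟨⟩-+ˡ {𝟘}     _        _        _        = refl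
⟨⟩-+ˡ {𝟙}     x        y        z        = ℤ.*-distribʳ-+ z x y
⟨⟩-+ˡ {A ⊕ B} (x , x′) (y , y′) (z , z′) = begin
  ⟨ x +ᵛ y ∣ z ⟩ + ⟨ x′ +ᵛ y′ ∣ z′ ⟩
    ≡⟨ cong₂ _+_ (⟨⟩-+ˡ x y z) (⟨⟩-+ˡ x′ y′ z′) ⟩
  (⟨ x ∣ z ⟩ + ⟨ y ∣ z ⟩) + (⟨ x′ ∣ z′ ⟩ + ⟨ y′ ∣ z′ ⟩)
    ≡⟨ +ᵛ-interchange {𝟙} ⟨ x ∣ z ⟩ _ _ _ ⟩
  (⟨ x ∣ z ⟩ + ⟨ x′ ∣ z′ ⟩) + (⟨ y ∣ z ⟩ + ⟨ y′ ∣ z′ ⟩) ∎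

⟨⟩-+ʳ : ∀ {A} (x y z : ⟦ A ⟧) → ⟨ x ∣ y +ᵛ z ⟩ ≡ ⟨ x ∣ y ⟩ + ⟨ x ∣ z ⟩
⟨⟩-+ʳ x y z = begin
  ⟨ x ∣ y +ᵛ z ⟩          ≡⟨ ⟨⟩-comm x _ ⟩
  ⟨ y +ᵛ z ∣ x ⟩          ≡⟨ ⟨⟩-+ˡ y z x ⟩
  ⟨ y ∣ x ⟩ + ⟨ z ∣ x ⟩   ≡⟨ cong₂ _+_ (⟨⟩-comm y x) (⟨⟩-comm z x) ⟩
  ⟨ x ∣ y ⟩ + ⟨ x ∣ z ⟩   ∎

⟨⟩-·ˡ : ∀ {A} c (x y : ⟦ A ⟧) → ⟨ c · x ∣ y ⟩ ≡ c ℤ.* ⟨ x ∣ y ⟩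
⟨⟩-·ˡ {𝟘}     c _        _        = sym (ℤ.*-zeroʳ c)
⟨⟩-·ˡ {𝟙}     c x        y        = ℤ.*-assoc c x y
⟨⟩-·ˡ {A ⊕ B} c (x , x′) (y , y′) =
  trans (cong₂ _+_ (⟨⟩-·ˡ c x y) (⟨⟩-·ˡ c x′ y′)) (sym (ℤ.*-distribˡ-+ c _ _))

⟨⟩-·ʳ : ∀ {A} c (x y : ⟦ A ⟧) → ⟨ x ∣ c · y ⟩ ≡ c ℤ.* ⟨ x ∣ y ⟩
⟨⟩-·ʳ c x y = trans (⟨⟩-comm x _) (trans (⟨⟩-·ˡ c y x) (cong (c ℤ.*_) (⟨⟩-comm y x)))

⟨⟩-0ˡ : ∀ {A} (x : ⟦ A ⟧) → ⟨ 0ᵛ ∣ x ⟩ ≡ 0ℤ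
⟨⟩-0ˡ {𝟘}     _       = refl
⟨⟩-0ˡ {𝟙}     x       = ℤ.*-zeroˡ x
⟨⟩-0ˡ {A ⊕ B} (x , y) = cong₂ _+_ (⟨⟩-0ˡ x) (⟨⟩-0ˡ y)

⟨⟩-0ʳ : ∀ {A} (x : ⟦ A ⟧) → ⟨ x ∣ 0ᵛ ⟩ ≡ 0ℤ
⟨⟩-0ʳ x = trans (⟨⟩-comm x 0ᵛ) (⟨⟩-0ˡ x)

-- Testing against all vectors turns the existence of an adjoint into linearity (`$-+`, `$-·`) and
-- makes the adjoint depend only on the values of the map (`ᵀ-cong`).
⟨⟩-nondegenerate : ∀ {A} {x y : ⟦ A ⟧} → (∀ z → ⟨ x ∣ z ⟩ ≡ ⟨ y ∣ z ⟩) → x ≡ y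
⟨⟩-nondegenerate {𝟘} _ = refl
⟨⟩-nondegenerate {𝟙} {x} {y} eq =
  trans (sym (ℤ.*-identityʳ x)) (trans (eq 1ℤ) (ℤ.*-identityʳ y))
⟨⟩-nondegenerate {A ⊕ B} {x , x′} {y , y′} eq = cong₂ _,_
  (⟨⟩-nondegenerate λ z → begin
    ⟨ x ∣ z ⟩                     ≡⟨ ℤ.+-identityʳ _ ⟨
    ⟨ x ∣ z ⟩ + 0ℤ                ≡⟨ cong (λ c → ⟨ x ∣ z ⟩ + c) (⟨⟩-0ʳ x′) ⟨
    ⟨ x ∣ z ⟩ + ⟨ x′ ∣ 0ᵛ ⟩       ≡⟨ eq (z , 0ᵛ) ⟩
    ⟨ y ∣ z ⟩ + ⟨ y′ ∣ 0ᵛ ⟩       ≡⟨ cong (λ c → ⟨ y ∣ z ⟩ + c) (⟨⟩-0ʳ y′) ⟩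
    ⟨ y ∣ z ⟩ + 0ℤ                ≡⟨ ℤ.+-identityʳ _ ⟩
    ⟨ y ∣ z ⟩                     ∎)
  (⟨⟩-nondegenerate λ z → begin
    ⟨ x′ ∣ z ⟩                    ≡⟨ ℤ.+-identityˡ _ ⟨
    0ℤ + ⟨ x′ ∣ z ⟩               ≡⟨ cong (_+ ⟨ x′ ∣ z ⟩) (⟨⟩-0ʳ x) ⟨
    ⟨ x ∣ 0ᵛ ⟩ + ⟨ x′ ∣ z ⟩       ≡⟨ eq (0ᵛ , z) ⟩
    ⟨ y ∣ 0ᵛ ⟩ + ⟨ y′ ∣ z ⟩       ≡⟨ cong (_+ ⟨ y′ ∣ z ⟩) (⟨⟩-0ʳ y) ⟩
    0ℤ + ⟨ y′ ∣ z ⟩               ≡⟨ ℤ.+-identityˡ _ ⟩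
    ⟨ y′ ∣ z ⟩                    ∎)

-- Having an adjoint makes a map linear, and provides transposes without bases.
infix 4 _⇒_
record _⇒_ (A B : Ob) : Set where
  no-eta-equality
  infixr 10 _$_
  field
    _$_     : ⟦ A ⟧ → ⟦ B ⟧
    adj     : ⟦ B ⟧ → ⟦ A ⟧
    adjoint : ∀ x y → ⟨ _$_ x ∣ y ⟩ ≡ ⟨ x ∣ adj y ⟩

open _⇒_ public using (_$_; adj; adjoint)

infix 11 _ᵀ
_ᵀ : A ⇒ B → B ⇒ A
(f ᵀ) ._$_ y       = adj f y
(f ᵀ) .adj x       = f $ x
(f ᵀ) .adjoint y x = trans (⟨⟩-comm (adj f y) x) (trans (sym (adjoint f x y)) (⟨⟩-comm (f $ x) y))

$-+ : (f : A ⇒ B) → ∀ x y → f $ (x +ᵛ y) ≡ f $ x +ᵛ f $ y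
$-+ f x y = ⟨⟩-nondegenerate λ z → begin
  ⟨ f $ (x +ᵛ y) ∣ z ⟩                ≡⟨ adjoint f _ z ⟩
  ⟨ x +ᵛ y ∣ adj f z ⟩                ≡⟨ ⟨⟩-+ˡ x y _ ⟩
  ⟨ x ∣ adj f z ⟩ + ⟨ y ∣ adj f z ⟩   ≡⟨ cong₂ _+_ (adjoint f x z) (adjoint f y z) ⟨
  ⟨ f $ x ∣ z ⟩ + ⟨ f $ y ∣ z ⟩       ≡⟨ ⟨⟩-+ˡ (f $ x) (f $ y) z ⟨
  ⟨ f $ x +ᵛ f $ y ∣ z ⟩              ∎

$-· : (f : A ⇒ B) → ∀ c x → f $ (c · x) ≡ c · f $ x
$-· f c x = ⟨⟩-nondegenerate λ z → begin
  ⟨ f $ (c · x) ∣ z ⟩     ≡⟨ adjoint f _ z ⟩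
  ⟨ c · x ∣ adj f z ⟩     ≡⟨ ⟨⟩-·ˡ c x _ ⟩
  c ℤ.* ⟨ x ∣ adj f z ⟩     ≡⟨ cong (c ℤ.*_) (adjoint f x z) ⟨
  c ℤ.* ⟨ f $ x ∣ z ⟩       ≡⟨ ⟨⟩-·ˡ c (f $ x) z ⟨
  ⟨ c · f $ x ∣ z ⟩       ∎

$-0 : (f : A ⇒ B) → f $ 0ᵛ ≡ 0ᵛ
$-0 f = trans (cong (f $_) (sym (·-zeroˡ 0ᵛ))) (trans ($-· f 0ℤ 0ᵛ) (·-zeroˡ _))

infix 4 _≗_
_≗_ : A ⇒ B → A ⇒ B → Set
f ≗ g = ∀ x → f $ x ≡ g $ x

ᵀ-cong : {f g : A ⇒ B} → f ≗ g → f ᵀ ≗ g ᵀ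
ᵀ-cong {f = f} {g} eq y = ⟨⟩-nondegenerate λ x → begin
  ⟨ adj f y ∣ x ⟩  ≡⟨ adjoint (f ᵀ) y x ⟩
  ⟨ y ∣ f $ x ⟩    ≡⟨ cong ⟨ y ∣_⟩ (eq x) ⟩
  ⟨ y ∣ g $ x ⟩    ≡⟨ adjoint (g ᵀ) y x ⟨
  ⟨ adj g y ∣ x ⟩  ∎

idₗ : A ⇒ A
idₗ ._$_ x       = x
idₗ .adj x       = x
idₗ .adjoint _ _ = refl

infixr 9 _∘_
_∘_ : B ⇒ A₁ → A ⇒ B → A ⇒ A₁
(f ∘ g) ._$_ x       = f $ g $ x
(f ∘ g) .adj z       = adj g (adj f z)
(f ∘ g) .adjoint x z = trans (adjoint f _ z) (adjoint g x _)

0ₗ : A ⇒ B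
0ₗ ._$_ _       = 0ᵛ
0ₗ .adj _       = 0ᵛ
0ₗ .adjoint x y = trans (⟨⟩-0ˡ y) (sym (⟨⟩-0ʳ x))

infixl 6 _+ₗ_
_+ₗ_ : A ⇒ B → A ⇒ B → A ⇒ B
(f +ₗ g) ._$_ x       = f $ x +ᵛ g $ x
(f +ₗ g) .adj y       = adj f y +ᵛ adj g y
(f +ₗ g) .adjoint x y = trans (⟨⟩-+ˡ (f $ x) (g $ x) y)
  (trans (cong₂ _+_ (adjoint f x y) (adjoint g x y)) (sym (⟨⟩-+ʳ x _ _)))

scale : ℤ → A ⇒ A
scale c ._$_ x       = c · x
scale c .adj x       = c · x
scale c .adjoint x y = trans (⟨⟩-·ˡ c x y) (sym (⟨⟩-·ʳ c x y))

pair : A ⇒ B → A ⇒ A₁ → A ⇒ B ⊕ A₁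
pair f g ._$_ x             = f $ x , g $ x
pair f g .adj (y , z)       = adj f y +ᵛ adj g z
pair f g .adjoint x (y , z) = trans (cong₂ _+_ (adjoint f x y) (adjoint g x z)) (sym (⟨⟩-+ʳ x _ _))

copair : A ⇒ A₁ → B ⇒ A₁ → A ⊕ B ⇒ A₁
copair f g ._$_ (x , y) = f $ x +ᵛ g $ y
copair f g .adj z       = adj f z , adj g z
copair f g .adjoint (x , y) z = trans (⟨⟩-+ˡ (f $ x) (g $ y) z) (cong₂ _+_ (adjoint f x z) (adjoint g y z))

infixr 6 _⊕ₗ_
_⊕ₗ_ : A ⇒ A₁ → B ⇒ B₁ → A ⊕ B ⇒ A₁ ⊕ B₁
(f ⊕ₗ g) ._$_ (x , y)             = f $ x , g $ y
(f ⊕ₗ g) .adj (z , w)             = adj f z , adj g w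
(f ⊕ₗ g) .adjoint (x , y) (z , w) = cong₂ _+_ (adjoint f x z) (adjoint g y w)

inl : A ⇒ A ⊕ B
inl ._$_ x             = x , 0ᵛ
inl .adj (y , z)       = y
inl .adjoint x (y , z) = trans (cong (λ c → ⟨ x ∣ y ⟩ + c) (⟨⟩-0ˡ z)) (ℤ.+-identityʳ _)

inr : B ⇒ A ⊕ B
inr ._$_ x             = 0ᵛ , x
inr .adj (y , z)       = z
inr .adjoint x (y , z) = trans (cong (_+ ⟨ x ∣ z ⟩) (⟨⟩-0ˡ y)) (ℤ.+-identityˡ _)

outl : A ⊕ B ⇒ A
outl = inl ᵀ

outr : A ⊕ B ⇒ B
outr = inr ᵀ

-- Isomorphisms and equivalence of maps

record IsIso (f : A ⇒ B) : Set where
  field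
    inv      : B ⇒ A
    inverseˡ : inv ∘ f ≗ idₗ
    inverseʳ : f ∘ inv ≗ idₗ

open IsIso public using (inv; inverseˡ; inverseʳ)

isIso-id : IsIso (idₗ {A})
isIso-id = record { inv = idₗ ; inverseˡ = λ _ → refl ; inverseʳ = λ _ → refl }

isIso-∘ : {f : B ⇒ A₁} {g : A ⇒ B} → IsIso f → IsIso g → IsIso (f ∘ g)
isIso-∘ {f = f} {g} i j = record
  { inv = inv j ∘ inv i
  ; inverseˡ = λ x → trans (cong (inv j $_) (inverseˡ i (g $ x))) (inverseˡ j x)
  ; inverseʳ = λ x → trans (cong (f $_) (inverseʳ j (inv i $ x))) (inverseʳ i x) }

isIso-cong : {f g : A ⇒ B} → f ≗ g → IsIso f → IsIso g
isIso-cong {f = f} eq i = record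
  { inv = inv i
  ; inverseˡ = λ x → trans (cong (inv i $_) (sym (eq x))) (inverseˡ i x)
  ; inverseʳ = λ x → trans (sym (eq _)) (inverseʳ i x) }

isIso-inv : {f : A ⇒ B} (i : IsIso f) → IsIso (inv i)
isIso-inv {f = f} i = record { inv = f ; inverseˡ = inverseʳ i ; inverseʳ = inverseˡ i }

isIso-ᵀ : {f : A ⇒ B} → IsIso f → IsIso (f ᵀ)
isIso-ᵀ {f = f} i = record
  { inv = inv i ᵀ
  ; inverseˡ = ᵀ-cong {f = f ∘ inv i} {idₗ} (inverseʳ i)
  ; inverseʳ = ᵀ-cong {f = inv i ∘ f} {idₗ} (inverseˡ i) }

isIso-⊕ : {f : A ⇒ B} {g : A₁ ⇒ B₁} → IsIso f → IsIso g → IsIso (f ⊕ₗ g)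
isIso-⊕ i j = record
  { inv = inv i ⊕ₗ inv j
  ; inverseˡ = λ (x , y) → cong₂ _,_ (inverseˡ i x) (inverseˡ j y)
  ; inverseʳ = λ (x , y) → cong₂ _,_ (inverseʳ i x) (inverseʳ j y) }

isIso-cancelˡ : {f : B ⇒ A₁} {g : A ⇒ B} → IsIso f → IsIso (f ∘ g) → IsIso g
isIso-cancelˡ {f = f} {g} i j =
  isIso-cong {f = inv i ∘ (f ∘ g)} (λ x → inverseˡ i (g $ x)) (isIso-∘ (isIso-inv i) j)

shear : A ⇒ B → A ⊕ B ⇒ A ⊕ B
shear h = pair outl (copair h idₗ)

isIso-shear : (h : A ⇒ B) → IsIso (shear h)
isIso-shear h = record
  { inv = shear (scale -1ℤ ∘ h)
  ; inverseˡ = λ (x , y) → cong (x ,_)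
      (trans (+ᵛ-comm _ (h $ x +ᵛ y)) (trans (cong (_+ᵛ -1ℤ · h $ x) (+ᵛ-comm (h $ x) y)) (x+y-y y (h $ x))))
  ; inverseʳ = λ (x , y) → cong (x ,_)
      (trans (+ᵛ-comm (h $ x) _) (trans (cong (_+ᵛ h $ x) (+ᵛ-comm _ y)) (x-y+y y (h $ x)))) }

Trivial : Ob → Set
Trivial A = ∀ (x y : ⟦ A ⟧) → x ≡ y

trivial-⊕ : Trivial A → Trivial B → Trivial (A ⊕ B)
trivial-⊕ t u (x , y) (x′ , y′) = cong₂ _,_ (t x x′) (u y y′)

isIso-trivial : {f : A ⇒ B} → Trivial A → Trivial B → IsIso f
isIso-trivial t u = record { inv = 0ₗ ; inverseˡ = λ _ → t _ _ ; inverseʳ = λ _ → u _ _ }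

infix 4 _∼_
-- Source and target are changed independently, as in integral equivalence. All four objects may
-- differ, so that operators on the cube can be compared with operators on polynomials.
record _∼_ (f : A ⇒ B) (g : A₁ ⇒ B₁) : Set where
  field
    {dom}  : A ⇒ A₁
    {cod}  : B ⇒ B₁
    domIso : IsIso dom
    codIso : IsIso cod
    square : cod ∘ f ≗ g ∘ dom

open _∼_ public

∼-refl : (f : A ⇒ B) → f ∼ f
∼-refl f = record { domIso = isIso-id ; codIso = isIso-id ; square = λ _ → refl }

∼-trans : {f : A ⇒ B} {g : A₁ ⇒ B₁} {h : A₂ ⇒ B₂} → f ∼ g → g ∼ h → f ∼ h
∼-trans {f = f} {g} {h} p q = record
  { domIso = isIso-∘ (domIso q) (domIso p)
  ; codIso = isIso-∘ (codIso q) (codIso p)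
  ; square = λ x → trans (cong (cod q $_) (square p x)) (square q (dom p $ x)) }

∼-sym : {f : A ⇒ B} {g : A₁ ⇒ B₁} → f ∼ g → g ∼ f
∼-sym {f = f} {g} p = record
  { domIso = isIso-inv (domIso p)
  ; codIso = isIso-inv (codIso p)
  ; square = λ x → begin
      inv (codIso p) $ g $ x
        ≡⟨ cong (λ z → inv (codIso p) $ g $ z) (inverseʳ (domIso p) x) ⟨
      inv (codIso p) $ g $ dom p $ inv (domIso p) $ x
        ≡⟨ cong (inv (codIso p) $_) (square p _) ⟨
      inv (codIso p) $ cod p $ f $ inv (domIso p) $ x
        ≡⟨ inverseˡ (codIso p) _ ⟩
      f $ inv (domIso p) $ x ∎ }

∼-ᵀ : {f : A ⇒ B} {g : A₁ ⇒ B₁} → f ∼ g → g ᵀ ∼ f ᵀ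
∼-ᵀ {f = f} {g} p = record
  { domIso = isIso-ᵀ (codIso p)
  ; codIso = isIso-ᵀ (domIso p)
  ; square = λ x → sym (ᵀ-cong {f = cod p ∘ f} {g ∘ dom p} (square p) x) }

∼-scale : ∀ c {f : A ⇒ B} {g : A₁ ⇒ B₁} → f ∼ g → scale c ∘ f ∼ scale c ∘ g
∼-scale c {f} p = record
  { domIso = domIso p
  ; codIso = codIso p
  ; square = λ x → trans ($-· (cod p) c (f $ x)) (cong (c ·_) (square p x)) }

∼-⊕ : {f : A ⇒ B} {g : A₁ ⇒ B₁} {f′ : A₂ ⇒ B₂} {g′ : A₃ ⇒ B₃} → f ∼ g → f′ ∼ g′ → f ⊕ₗ f′ ∼ g ⊕ₗ g′
∼-⊕ p q = record
  { domIso = isIso-⊕ (domIso p) (domIso q)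
  ; codIso = isIso-⊕ (codIso p) (codIso q)
  ; square = λ (x , y) → cong₂ _,_ (square p x) (square q y) }

-- The operator on polynomials in one variable

Poly : ℕ → Ob
Poly zero    = 𝟘
Poly (suc j) = 𝟙 ⊕ Poly j

shift : ∀ {j} → Poly j ⇒ Poly (suc j)
shift = inr

-- f ↦ b (j f - t f′) + ε f′
lower : ∀ (ε b : ℤ) j → Poly (suc j) ⇒ Poly j
lower ε b zero    = 0ₗ
lower ε b (suc j) = copair (inl ∘ scale (b ℤ.* + suc j)) (scale ε +ₗ shift ∘ lower ε b j)

-- (y , g) ↦ y tʲ + (1 - 2t) g
graft : ∀ j → 𝟙 ⊕ Poly j ⇒ Poly (suc j)
graft zero    = idₗ
graft (suc j) = shear (inl ∘ scale -[1+ 1 ]) ∘ (idₗ ⊕ₗ graft j) ∘ pair (outl ∘ outr) (pair outl (outr ∘ outr))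

isIso-swap : IsIso {A ⊕ B ⊕ A₁} (pair (outl ∘ outr) (pair outl (outr ∘ outr)))
isIso-swap = record
  { inv = pair (outl ∘ outr) (pair outl (outr ∘ outr))
  ; inverseˡ = λ _ → refl ; inverseʳ = λ _ → refl }

isIso-graft : ∀ j → IsIso (graft j)
isIso-graft zero    = isIso-id
isIso-graft (suc j) = isIso-∘ (isIso-shear _)
  (isIso-∘ (isIso-⊕ isIso-id (isIso-graft j)) isIso-swap)

lower-inl : ∀ ε b j c → lower ε b (suc j) $ (c , 0ᵛ) ≡ inl $ (b ℤ.* + suc j ℤ.* c)
lower-inl ε b j c = begin
  (b ℤ.* + suc j ℤ.* c , 0ᵛ) +ᵛ (ε · 0ᵛ +ᵛ (0ℤ , lower ε b j $ 0ᵛ))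
    ≡⟨ cong ((b ℤ.* + suc j ℤ.* c , 0ᵛ) +ᵛ_)
         (cong₂ _+ᵛ_ (·-zeroʳ {Poly (suc j)} ε) (cong (0ℤ ,_) ($-0 (lower ε b j)))) ⟩
  (b ℤ.* + suc j ℤ.* c , 0ᵛ) +ᵛ (0ᵛ +ᵛ 0ᵛ)
    ≡⟨ trans (cong ((b ℤ.* + suc j ℤ.* c , 0ᵛ) +ᵛ_) (+ᵛ-identityˡ {Poly (suc j)} 0ᵛ))
         (+ᵛ-identityʳ {Poly (suc j)} (b ℤ.* + suc j ℤ.* c , 0ᵛ)) ⟩
  b ℤ.* + suc j ℤ.* c , 0ᵛ ∎

lower-shift : ∀ ε b j f → lower ε b (suc j) $ shift $ f ≡ ε · f +ᵛ shift $ lower ε b j $ f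
lower-shift ε b j f = trans
  (cong (λ c → (c , 0ᵛ) +ᵛ (ε · f +ᵛ shift $ lower ε b j $ f)) (ℤ.*-zeroʳ (b ℤ.* + suc j)))
  (+ᵛ-identityˡ (ε · f +ᵛ shift $ lower ε b j $ f))

-- Write L for the operator with r = j + 1. On tʲ⁺¹ its two terms of degree j + 1 cancel, which
-- leaves (j + 1) tʲ. On (1 - 2t) g the product rule contributes -2 (1 - 2t) g, which lowers r by
-- one: the factor 1 - 2t comes out and the operator for j acts on g.
lower-graft : ∀ j y g → lower 1ℤ (+ 2) (suc j) $ graft (suc j) $ (y , g)
                      ≡ graft j $ (+ suc j ℤ.* y , lower 1ℤ (+ 2) j $ g)
lower-graft zero y (g , _) = cong (_, tt) (ring-law y g)
  where
  ring-law : ∀ y g → + 2 ℤ.* + 1 ℤ.* g + (1ℤ ℤ.* (-[1+ 1 ] ℤ.* g + y) + 0ℤ) ≡ + 1 ℤ.* y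
  ring-law = solve-∀
lower-graft (suc j) y (g₀ , g₁ , g) = cong₂ _,_
  -- The grafted polynomial is `g₀` + t `h`, and `P` is in turn the tail of `h`. Constant
  -- coefficients and tails are compared separately.
  (head (+ suc j) g₀ g₁)
  (begin
    0ᵛ +ᵛ (1ℤ · (0ᵛ +ᵛ P) +ᵛ L $ h)
      ≡⟨ trans (+ᵛ-identityˡ _) (cong (_+ᵛ L $ h) (trans (·-identityˡ _) (+ᵛ-identityˡ P))) ⟩
    P +ᵛ L $ h
      ≡⟨ cong (P +ᵛ_) ($-+ L (inl $ (-[1+ 1 ] ℤ.* g₀)) (graft (suc j) $ (y , g₁ , g))) ⟩
    P +ᵛ (L $ inl $ (-[1+ 1 ] ℤ.* g₀) +ᵛ L $ graft (suc j) $ (y , g₁ , g))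
      ≡⟨ cong (P +ᵛ_) (cong₂ _+ᵛ_ (lower-inl 1ℤ (+ 2) j (-[1+ 1 ] ℤ.* g₀)) (lower-graft j y (g₁ , g))) ⟩
    P +ᵛ (inl $ (+ 2 ℤ.* + suc j ℤ.* (-[1+ 1 ] ℤ.* g₀)) +ᵛ graft j $ (+ suc j ℤ.* y , v))
      ≡⟨ +ᵛ-interchange (inl $ (-[1+ 1 ] ℤ.* g₁)) _ _ _ ⟩
    (inl $ (-[1+ 1 ] ℤ.* g₁) +ᵛ inl $ (+ 2 ℤ.* + suc j ℤ.* (-[1+ 1 ] ℤ.* g₀)))
      +ᵛ (graft j $ (y , g) +ᵛ graft j $ (+ suc j ℤ.* y , v))
      ≡⟨ cong₂ _+ᵛ_ ($-+ inl (-[1+ 1 ] ℤ.* g₁) _) ($-+ (graft j) (y , g) _) ⟨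
    inl $ (-[1+ 1 ] ℤ.* g₁ + + 2 ℤ.* + suc j ℤ.* (-[1+ 1 ] ℤ.* g₀)) +ᵛ graft j $ (y + + suc j ℤ.* y , g +ᵛ v)
      ≡⟨ cong₂ _+ᵛ_ (cong (inl $_) (tail (+ suc j) g₀ g₁))
           (cong₂ (λ a b → graft j $ (a , b)) (sym (ℤ.suc-* (+ suc j) y))
             (sym (trans (+ᵛ-identityˡ _) (cong (_+ᵛ v) (·-identityˡ g))))) ⟩
    inl $ (-[1+ 1 ] ℤ.* (+ 2 ℤ.* + suc j ℤ.* g₀ + (1ℤ ℤ.* g₁ + 0ℤ)))
      +ᵛ graft j $ (+ suc (suc j) ℤ.* y , 0ᵛ +ᵛ (1ℤ · g +ᵛ v)) ∎)
  where
  L = lower 1ℤ (+ 2) (suc j)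
  v = lower 1ℤ (+ 2) j $ (g₁ , g)
  P = inl $ (-[1+ 1 ] ℤ.* g₁) +ᵛ graft j $ (y , g)
  h = inl $ (-[1+ 1 ] ℤ.* g₀) +ᵛ graft (suc j) $ (y , g₁ , g)
  head : ∀ s g₀ g₁ → + 2 ℤ.* (1ℤ + s) ℤ.* g₀ + (1ℤ ℤ.* (-[1+ 1 ] ℤ.* g₀ + g₁) + 0ℤ) ≡ + 2 ℤ.* s ℤ.* g₀ + (1ℤ ℤ.* g₁ + 0ℤ)
  head = solve-∀
  tail : ∀ s g₀ g₁ → -[1+ 1 ] ℤ.* g₁ + + 2 ℤ.* s ℤ.* (-[1+ 1 ] ℤ.* g₀) ≡ -[1+ 1 ] ℤ.* (+ 2 ℤ.* s ℤ.* g₀ + (1ℤ ℤ.* g₁ + 0ℤ))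
  tail = solve-∀

-- The substitution tᵃ ↦ (1 - 2t)ᵃ tʲ⁻¹⁻ᵃ: the constant coefficient goes to the pure power of t, and
-- each further coefficient takes up one more factor 1 - 2t.
expand : ∀ j → Poly j ⇒ Poly j
expand zero    = idₗ
expand (suc j) = graft j ∘ (idₗ ⊕ₗ expand j)

isIso-expand : ∀ j → IsIso (expand j)
isIso-expand zero    = isIso-id
isIso-expand (suc j) = isIso-∘ (isIso-graft j) (isIso-⊕ isIso-id (isIso-expand j))

lower-expand : ∀ j → lower 1ℤ (+ 2) j ∘ expand (suc j) ≗ expand j ∘ lower 0ℤ (+ 1) j
lower-expand zero    _       = refl
lower-expand (suc j) (y , g) = begin
  lower 1ℤ (+ 2) (suc j) $ graft (suc j) $ (y , expand (suc j) $ g)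
    ≡⟨ lower-graft j y _ ⟩
  graft j $ (+ suc j ℤ.* y , lower 1ℤ (+ 2) j $ expand (suc j) $ g)
    ≡⟨ cong (λ z → graft j $ (+ suc j ℤ.* y , z)) (lower-expand j g) ⟩
  graft j $ (+ suc j ℤ.* y , expand j $ lower 0ℤ (+ 1) j $ g)
    ≡⟨ cong (λ z → expand (suc j) $ z) diagonal-step ⟨
  expand (suc j) $ lower 0ℤ (+ 1) (suc j) $ (y , g) ∎
  where
  w : ⟦ Poly (suc j) ⟧
  w = shift $ lower 0ℤ (+ 1) j $ g
  diagonal-step : lower 0ℤ (+ 1) (suc j) $ (y , g) ≡ (+ suc j ℤ.* y , lower 0ℤ (+ 1) j $ g)
  diagonal-step = trans
    (cong ((+ 1 ℤ.* + suc j ℤ.* y , 0ᵛ) +ᵛ_) (trans (cong (_+ᵛ w) (·-zeroˡ g)) (+ᵛ-identityˡ w)))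
    (cong₂ _,_ (trans (ℤ.+-identityʳ _) (cong (ℤ._* y) (ℤ.*-identityˡ (+ suc j)))) (+ᵛ-identityˡ (lower 0ℤ (+ 1) j $ g)))

-- Sums over ballot sequences

-- The coefficient of tᴺ, absent if N ≥ j
Top : ℕ → ℕ → Ob
Top N       zero    = 𝟘
Top zero    (suc j) = 𝟙
Top (suc N) (suc j) = Top N j

top : ∀ N j → Poly j ⇒ Top N j
top N       zero    = idₗ
top zero    (suc j) = outl
top (suc N) (suc j) = top N j ∘ outr

Trunc : ℕ → ℕ → Ob
Trunc zero    j = 𝟘
Trunc (suc N) j = Trunc N j ⊕ Top N j

trunc : ∀ N j → Poly j ⇒ Trunc N j
trunc zero    j = 0ₗ
trunc (suc N) j = pair (trunc N j) (top N j)

trivial-Trunc : ∀ N → Trivial (Trunc N 0)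
trivial-Trunc zero    = λ _ _ → refl
trivial-Trunc (suc N) = trivial-⊕ (trivial-Trunc N) λ _ _ → refl

-- `Trunc` grows at the highest coefficient, `Poly` at the constant one; this map translates, since
-- `glue` has to work at both ends.
cons : ∀ N j → 𝟙 ⊕ Trunc N j ⇒ Trunc (suc N) (suc j)
cons zero    j = pair outr outl
cons (suc N) j = (cons N j ⊕ₗ idₗ) ∘ pair (pair outl (outl ∘ outr)) (outr ∘ outr)

isIso-cons : ∀ N j → IsIso (cons N j)
isIso-cons zero j = record
  { inv = pair outr outl ; inverseˡ = λ _ → refl ; inverseʳ = λ _ → refl }
isIso-cons (suc N) j = isIso-∘ (isIso-⊕ (isIso-cons N j) isIso-id) record
  { inv = pair (outl ∘ outl) (pair (outr ∘ outl) outr)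
  ; inverseˡ = λ _ → refl ; inverseʳ = λ _ → refl }

cons-trunc : ∀ N j → cons N j ∘ (idₗ ⊕ₗ trunc N j) ≗ trunc (suc N) (suc j)
cons-trunc zero    j _       = refl
cons-trunc (suc N) j (x , f) = cong (_, top N j $ f) (cons-trunc N j (x , f))

isIso-trunc : ∀ N j → j ≤ N → IsIso (trunc N j)
isIso-trunc N       zero    _         = isIso-trivial (λ _ _ → refl) (trivial-Trunc N)
isIso-trunc (suc N) (suc j) (s≤s j≤N) =
  isIso-cong (cons-trunc N j) (isIso-∘ (isIso-cons N j) (isIso-⊕ isIso-id (isIso-trunc N j j≤N)))

mix : ∀ A B → (𝟙 ⊕ A) ⊕ (A ⊕ B) ⇒ (𝟙 ⊕ A ⊕ B) ⊕ A
mix A B = pair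
  (pair (outl ∘ outl) (pair (outr ∘ outl +ₗ outl ∘ outr) (outr ∘ outr)))
  (outl ∘ outr)

isIso-mix : ∀ A B → IsIso (mix A B)
isIso-mix A B = record
  { inv = pair
      (pair (outl ∘ outl) (outl ∘ outr ∘ outl +ₗ scale -1ℤ ∘ outr))
      (pair outr (outr ∘ outr ∘ outl))
  ; inverseˡ = λ ((x , a) , b , c) → cong (λ z → (x , z) , b , c) (x+y-y a b)
  ; inverseʳ = λ ((x , a , c) , b) → cong (λ z → (x , z , c) , b) (x-y+y a b) }

-- The map (f , g) ↦ (f + t g , g), where f and g are known modulo tᴺ⁺¹ and the results are wanted
-- modulo tᴺ⁺² and tᴺ. No information is lost: the last coefficient of g survives as the top
-- coefficient of f + t g.
glue : ∀ N j → Trunc (suc N) (suc j) ⊕ Trunc (suc N) j ⇒ Trunc (suc (suc N)) (suc j) ⊕ Trunc N j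
glue N j = (cons (suc N) j ⊕ₗ idₗ) ∘ mix _ _ ∘ (inv (isIso-cons N j) ⊕ₗ idₗ)

isIso-glue : ∀ N j → IsIso (glue N j)
isIso-glue N j = isIso-∘ (isIso-⊕ (isIso-cons (suc N) j) isIso-id)
  (isIso-∘ (isIso-mix _ _) (isIso-⊕ (isIso-inv (isIso-cons N j)) isIso-id))

-- The top coefficient of f + t g also involves the coefficient of tᴺ⁺¹ in f, which lies beyond the
-- truncation of f. It is put where the coefficient of tᴺ in g stands, because both enter f + t g in
-- the same degree.
overflow : ∀ N j → Poly (suc j) ⇒ Trunc (suc N) j
overflow N j = inr ∘ top N j ∘ outr

glue-inl : ∀ N j f → glue N j $ (trunc (suc N) (suc j) $ f , overflow N j $ f)
                   ≡ (trunc (suc (suc N)) (suc j) $ f , 0ᵛ)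
glue-inl N j (x , f) = cong (_, 0ᵛ) (begin
  cons (suc N) j $ (proj₁ u , proj₂ u +ᵛ 0ᵛ , top N j $ f)
    ≡⟨ cong (λ v → cons (suc N) j $ (proj₁ v , proj₂ v +ᵛ 0ᵛ , top N j $ f)) uncons ⟩
  cons (suc N) j $ (x , trunc N j $ f +ᵛ 0ᵛ , top N j $ f)
    ≡⟨ cong (λ v → cons (suc N) j $ (x , v , top N j $ f)) (+ᵛ-identityʳ _) ⟩
  cons (suc N) j $ (x , trunc (suc N) j $ f)
    ≡⟨ cons-trunc (suc N) j (x , f) ⟩
  trunc (suc (suc N)) (suc j) $ (x , f) ∎)
  where
  u = inv (isIso-cons N j) $ trunc (suc N) (suc j) $ (x , f)
  uncons : u ≡ (x , trunc N j $ f)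
  uncons = trans (cong (inv (isIso-cons N j) $_) (sym (cons-trunc N j (x , f)))) (inverseˡ (isIso-cons N j) _)

glue-inr : ∀ N j g → glue N j $ (0ᵛ , trunc (suc N) j $ g)
                   ≡ (trunc (suc (suc N)) (suc j) $ shift $ g , trunc N j $ g)
glue-inr N j g = cong (_, trunc N j $ g) (begin
  cons (suc N) j $ (proj₁ u , proj₂ u +ᵛ trunc N j $ g , top N j $ g)
    ≡⟨ cong (λ v → cons (suc N) j $ (proj₁ v , proj₂ v +ᵛ trunc N j $ g , top N j $ g))
         ($-0 (inv (isIso-cons N j))) ⟩
  cons (suc N) j $ (0ᵛ , 0ᵛ +ᵛ trunc N j $ g , top N j $ g)
    ≡⟨ cong (λ v → cons (suc N) j $ (0ᵛ , v , top N j $ g)) (+ᵛ-identityˡ _) ⟩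
  cons (suc N) j $ (0ᵛ , trunc (suc N) j $ g)
    ≡⟨ cons-trunc (suc N) j (0ᵛ , g) ⟩
  trunc (suc (suc N)) (suc j) $ shift $ g ∎)
  where
  u = inv (isIso-cons N j) $ 0ᵛ

Family : Set
Family = ℕ → ℕ → Ob

-- A new element either stays outside T, which raises N by one, or joins T, which lowers N by one.
-- At N = 0 the ballot condition is already violated and the branch ends.
Step : Family → Family
Step Z zero    s = 𝟘
Step Z (suc N) s = Z (suc (suc N)) s ⊕ Z N (suc s)

-- The summands of Bal n Z belong to the sequences T of length n that are ballot up to their last
-- entry, with s = |T| and N = n + 1 - 2 |T|; if T itself is not ballot, then N = 0.
Bal : ℕ → Family → Ob
Bal zero    Z = Z 1 0
Bal (suc n) Z = Bal n (Step Z)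

infix 4 _⇛_
_⇛_ : Family → Family → Set
Z ⇛ W = ∀ N s → Z N s ⇒ W N s

private variable
  Z Z′ W W′ : Family

step : Z ⇛ W → Step Z ⇛ Step W
step h zero    s = idₗ
step h (suc N) s = h (suc (suc N)) s ⊕ₗ h N (suc s)

bal : ∀ n → Z ⇛ W → Bal n Z ⇒ Bal n W
bal zero    h = h 1 0
bal (suc n) h = bal n (step h)

bal-cong : ∀ n {h k : Z ⇛ W} → (∀ N s → h N s ≗ k N s) → bal n h ≗ bal n k
bal-cong zero    eq = eq 1 0
bal-cong (suc n) eq = bal-cong n λ
  { zero s _ → refl ; (suc N) s (x , y) → cong₂ _,_ (eq _ _ x) (eq _ _ y) }

bal-id : ∀ n → bal n (λ N s → idₗ {Z N s}) ≗ idₗ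
bal-id zero        x = refl
bal-id {Z} (suc n) x =
  trans (bal-cong n {k = λ N s → idₗ} (λ { zero s _ → refl ; (suc N) s _ → refl }) x) (bal-id n x)

bal-0 : ∀ n → bal n (λ N s → 0ₗ {Z N s} {W N s}) ≗ 0ₗ
bal-0 zero    x = refl
bal-0 (suc n) x =
  trans (bal-cong n {k = λ N s → 0ₗ} (λ { zero s _ → refl ; (suc N) s _ → refl }) x) (bal-0 n x)

bal-scale : ∀ n c → bal n (λ N s → scale {Z N s} c) ≗ scale c
bal-scale zero    c x = refl
bal-scale (suc n) c x =
  trans (bal-cong n {k = λ N s → scale c} (λ { zero s _ → refl ; (suc N) s _ → refl }) x) (bal-scale n c x)

bal-∘ : ∀ n (h : Z′ ⇛ W) (k : Z ⇛ Z′) → bal n h ∘ bal n k ≗ bal n (λ N s → h N s ∘ k N s)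
bal-∘ zero    h k x = refl
bal-∘ (suc n) h k x = trans (bal-∘ n (step h) (step k) x)
  (bal-cong n (λ { zero s _ → refl ; (suc N) s _ → refl }) x)

bal-+ : ∀ n (h k : Z ⇛ W) x → bal n h $ x +ᵛ bal n k $ x ≡ bal n (λ N s → h N s +ₗ k N s) $ x
bal-+ zero    h k x = refl
bal-+ (suc n) h k x = trans (bal-+ n (step h) (step k) x)
  (bal-cong n (λ { zero s _ → refl ; (suc N) s _ → refl }) x)

bal-square : ∀ n {h : Z′ ⇛ W} {k : Z ⇛ Z′} {h′ : W′ ⇛ W} {k′ : Z ⇛ W′} →
  (∀ N s → h N s ∘ k N s ≗ h′ N s ∘ k′ N s) → bal n h ∘ bal n k ≗ bal n h′ ∘ bal n k′
bal-square n {h} {k} {h′} {k′} eq x =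
  trans (bal-∘ n h k x) (trans (bal-cong n eq x) (sym (bal-∘ n h′ k′ x)))

-- The equation N + 2 s = n + 1 is preserved by both branches of `Step`; it is all that the leaf
-- maps need to know about T.
isIso-bal : ∀ n {h : Z ⇛ W} → (∀ N s → N ℕ.+ 2 ℕ.* s ≡ suc n → IsIso (h N s)) → IsIso (bal n h)
isIso-bal zero    i = i 1 0 refl
isIso-bal (suc n) i = isIso-bal n λ
  { zero    s eq → isIso-id
  ; (suc N) s eq → isIso-⊕ (i (suc (suc N)) s (cong suc eq))
      (i N (suc s) (trans (cong (N ℕ.+_) (ℕ.*-suc 2 s)) (trans (ℕ.+-suc N _) (cong suc (trans (ℕ.+-suc N _) eq))))) }

bal-copair : ∀ n → (∀ N s → Z N s ⊕ Z′ N s ⇒ W N s) → Bal n Z ⊕ Bal n Z′ ⇒ Bal n W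
bal-copair n h = copair (bal n (λ N s → h N s ∘ inl)) (bal n (λ N s → h N s ∘ inr))

-- A pair of sums over ballot sequences is not by definition the sum of pairs. The leafwise inverse
-- is therefore cut into its two components, and the matrix identities between the components are
-- lifted one by one.
isIso-bal-copair : ∀ n {h : ∀ N s → Z N s ⊕ Z′ N s ⇒ W N s} →
  (∀ N s → IsIso (h N s)) → IsIso (bal-copair n h)
isIso-bal-copair {Z} {Z′} n {h} i = record
  { inv = pair (bal n p) (bal n q)
  ; inverseˡ = λ (x , y) → cong₂ _,_
      (trans ($-+ (bal n p) (bal n l $ x) (bal n r $ y)) (trans
        (cong₂ _+ᵛ_ (id-law {Z} p l (λ N s x → cong proj₁ (inverseˡ (i N s) (x , 0ᵛ))) x)
                    (zero-law {Z′} {Z} p r (λ N s y → cong proj₁ (inverseˡ (i N s) (0ᵛ , y))) y))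
        (+ᵛ-identityʳ x)))
      (trans ($-+ (bal n q) (bal n l $ x) (bal n r $ y)) (trans
        (cong₂ _+ᵛ_ (zero-law {Z} {Z′} q l (λ N s x → cong proj₂ (inverseˡ (i N s) (x , 0ᵛ))) x)
                    (id-law {Z′} q r (λ N s y → cong proj₂ (inverseˡ (i N s) (0ᵛ , y))) y))
        (+ᵛ-identityˡ y)))
  ; inverseʳ = λ z → begin
      bal n l $ bal n p $ z +ᵛ bal n r $ bal n q $ z
        ≡⟨ cong₂ _+ᵛ_ (bal-∘ n l p z) (bal-∘ n r q z) ⟩
      bal n (λ N s → l N s ∘ p N s) $ z +ᵛ bal n (λ N s → r N s ∘ q N s) $ z
        ≡⟨ bal-+ n _ _ z ⟩
      bal n (λ N s → l N s ∘ p N s +ₗ r N s ∘ q N s) $ z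
        ≡⟨ bal-cong n (λ N s z → trans (sym ($-+ (h N s) _ _))
             (trans (cong (h N s $_) (cong₂ _,_ (+ᵛ-identityʳ _) (+ᵛ-identityˡ _))) (inverseʳ (i N s) z))) z ⟩
      bal n (λ N s → idₗ) $ z
        ≡⟨ bal-id n z ⟩
      z ∎ }
  where
  l = λ N s → h N s ∘ inl
  r = λ N s → h N s ∘ inr
  p = λ N s → outl ∘ inv (i N s)
  q = λ N s → outr ∘ inv (i N s)
  id-law : ∀ {X Y} (a : Y ⇛ X) (b : X ⇛ Y) → (∀ N s → a N s ∘ b N s ≗ idₗ) → bal n a ∘ bal n b ≗ idₗ
  id-law a b eq x = trans (bal-∘ n a b x) (trans (bal-cong n eq x) (bal-id n x))
  zero-law : ∀ {X X′ Y} (a : Y ⇛ X′) (b : X ⇛ Y) → (∀ N s → a N s ∘ b N s ≗ 0ₗ) → bal n a ∘ bal n b ≗ 0ₗ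
  zero-law a b eq x = trans (bal-∘ n a b x) (trans (bal-cong n eq x) (bal-0 n x))

-- Operators on the cube

-- Read either as functions on the vertices or as coefficients of the monomials t_S. The first half
-- has first coordinate 0, respectively belongs to the sets without the first element.
F : ℕ → Ob
F zero    = 𝟙
F (suc n) = F n ⊕ F n

Bit : Bool → Ob
Bit true  = 𝟙
Bit false = 𝟘

bit : ∀ b → Bit b ⇒ 𝟙
bit true  = idₗ
bit false = 0ₗ

-- The predicate is a condition on |S|; it is shifted on the half where S contains the first
-- element.
Sub : ℕ → (ℕ → Bool) → Ob
Sub zero    p = Bit (p 0)
Sub (suc n) p = Sub n p ⊕ Sub n (p Fun.∘ suc)

incl : ∀ n p → Sub n p ⇒ F n
incl zero    p = bit (p 0)
incl (suc n) p = incl n p ⊕ₗ incl n (p Fun.∘ suc)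

restrict-incl : ∀ n p → incl n p ᵀ ∘ incl n p ≗ idₗ
restrict-incl zero p x with p 0
... | true  = refl
... | false = refl
restrict-incl (suc n) p (x , y) = cong₂ _,_ (restrict-incl n p x) (restrict-incl n _ y)

trivial-Sub : ∀ n p → (∀ l → p l ≡ false) → Trivial (Sub n p)
trivial-Sub zero    p eq with p 0 | eq 0
... | false | _ = λ _ _ → refl
trivial-Sub (suc n) p eq = trivial-⊕ (trivial-Sub n p eq) (trivial-Sub n _ (eq Fun.∘ suc))

-- On coefficients of monomials: t_S ↦ b (c - |S|) t_S + ε ∑_{i ∈ S} t_{S - i}
op : (ε b : ℤ) (n : ℕ) → ℤ → F n ⇒ F n
op ε b zero    c = scale (b ℤ.* c)
op ε b (suc n) c = pair (copair (op ε b n c) (scale ε)) (op ε b n (pred c) ∘ outr)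

block : ∀ {n} p q → F n ⇒ F n → Sub n p ⇒ Sub n q
block {n} p q f = incl n q ᵀ ∘ f ∘ incl n p

Low : ℕ → ℕ → Ob
Low n k = Sub n (_<ᵇ k)

lowOp : (ε b : ℤ) (n k : ℕ) → Low n (suc k) ⇒ Low n k
lowOp ε b n k = block (_<ᵇ suc k) (_<ᵇ k) (op ε b n (+ k))

lowOp-suc : ∀ ε b n k f g → lowOp ε b (suc n) (suc k) $ (f , g)
                          ≡ (lowOp ε b n (suc k) $ f +ᵛ ε · g , lowOp ε b n k $ g)
lowOp-suc ε b n k f g = cong (_, lowOp ε b n k $ g) (begin
  π $ (op ε b n (+ suc k) $ incl n _ $ f +ᵛ ε · incl n _ $ g)
    ≡⟨ $-+ π (op ε b n (+ suc k) $ incl n _ $ f) _ ⟩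
  lowOp ε b n (suc k) $ f +ᵛ π $ (ε · incl n _ $ g)
    ≡⟨ cong (lowOp ε b n (suc k) $ f +ᵛ_)
         (trans ($-· π ε _) (cong (ε ·_) (restrict-incl n (_<ᵇ suc k) g))) ⟩
  lowOp ε b n (suc k) $ f +ᵛ ε · g ∎)
  where π = incl n (_<ᵇ suc k) ᵀ

trivial-Bal : ∀ n {Z : Family} → (∀ N s → Trivial (Z N s)) → Trivial (Bal n Z)
trivial-Bal zero    t = t 1 0
trivial-Bal (suc n) t = trivial-Bal n λ
  { zero s → λ _ _ → refl ; (suc N) s → trivial-⊕ (t _ _) (t _ _) }

-- Coordinates on the low degrees

Pol Tru : ℕ → Family
Pol k N s = Poly (k ∸ s)
Tru k N s = Trunc N (k ∸ s)

trivial-Poly : ∀ s → Trivial (Poly (0 ∸ s))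
trivial-Poly s rewrite ℕ.0∸n≡0 s = λ _ _ → refl

trivial-Tru : ∀ N s → Trivial (Tru 0 N s)
trivial-Tru N s rewrite ℕ.0∸n≡0 s = trivial-Trunc N

-- Multiplication by t. The simultaneous recursion is there because `suc k ∸ s` is a successor only
-- for s ≤ k; otherwise the source is zero.
shiftAt : ∀ k s → Poly (k ∸ s) ⇒ Poly (suc k ∸ s)
shiftAt k       zero    = shift
shiftAt zero    (suc s) = 0ₗ
shiftAt (suc k) (suc s) = shiftAt k s

left : ∀ k → Pol (suc k) ⇛ Step (Pol (suc k))
left k zero    s = 0ₗ
left k (suc N) s = inl

right : ∀ k → Pol k ⇛ Step (Pol (suc k))
right k zero    s = 0ₗ
right k (suc N) s = pair (shiftAt k s) idₗ

-- Let f and g be the polynomials of T for the coefficients at sets without and with the new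
-- element. Then T itself gets f + t g, and T with the new element gets g, whose degrees are now
-- counted from |T| + 1.
coords : ∀ n k → Low n k ⇒ Bal n (Pol k)
coords zero    zero    = 0ₗ
coords zero    (suc k) = inl
coords (suc n) zero    = 0ₗ
coords (suc n) (suc k) = copair (bal n (left k) ∘ coords n (suc k)) (bal n (right k) ∘ coords n k)

lowerAt : ∀ (ε b : ℤ) k s → Poly (suc k ∸ s) ⇒ Poly (k ∸ s)
lowerAt ε b k       zero    = lower ε b k
lowerAt ε b zero    (suc s) = 0ₗ
lowerAt ε b (suc k) (suc s) = lowerAt ε b k s

lowerPol : ∀ (ε b : ℤ) k → Pol (suc k) ⇛ Pol k
lowerPol ε b k N s = lowerAt ε b k s

lowerAt-shiftAt : ∀ ε b k s f → lowerAt ε b (suc k) s $ shiftAt (suc k) s $ f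
                              ≡ ε · f +ᵛ shiftAt k s $ lowerAt ε b k s $ f
lowerAt-shiftAt ε b k       zero    f = lower-shift ε b k f
lowerAt-shiftAt ε b zero    (suc s) f = trivial-Poly s _ _
lowerAt-shiftAt ε b (suc k) (suc s) f = lowerAt-shiftAt ε b k s f

coords-lowOp : ∀ ε b n k → coords n k ∘ lowOp ε b n k ≗ bal n (lowerPol ε b k) ∘ coords n (suc k)
coords-lowOp ε b zero    zero    x = refl
coords-lowOp ε b zero    (suc k) x = sym (lower-inl ε b k x)
coords-lowOp ε b (suc n) zero    x = trivial-Bal (suc n) (λ N → trivial-Poly) _ _
coords-lowOp ε b (suc n) (suc k) (f , g) = begin
  coords (suc n) (suc k) $ lowOp ε b (suc n) (suc k) $ (f , g)
    ≡⟨ cong (coords (suc n) (suc k) $_) (lowOp-suc ε b n k f g) ⟩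
  bal n u′ $ coords n (suc k) $ (lowOp ε b n (suc k) $ f +ᵛ ε · g) +ᵛ bal n v′ $ coords n k $ lowOp ε b n k $ g
    ≡⟨ cong₂ _+ᵛ_
         (cong (bal n u′ $_) (trans ($-+ (coords n (suc k)) (lowOp ε b n (suc k) $ f) _)
           (cong₂ _+ᵛ_ (coords-lowOp ε b n (suc k) f) ($-· (coords n (suc k)) ε g))))
         (cong (bal n v′ $_) (coords-lowOp ε b n k g)) ⟩
  bal n u′ $ (bal n ℓ′ $ x +ᵛ ε · y) +ᵛ bal n v′ $ bal n ℓ $ y
    ≡⟨ cong (_+ᵛ bal n v′ $ bal n ℓ $ y) ($-+ (bal n u′) (bal n ℓ′ $ x) _) ⟩
  bal n u′ $ bal n ℓ′ $ x +ᵛ bal n u′ $ (ε · y) +ᵛ bal n v′ $ bal n ℓ $ y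
    ≡⟨ +ᵛ-assoc (bal n u′ $ bal n ℓ′ $ x) _ _ ⟩
  bal n u′ $ bal n ℓ′ $ x +ᵛ (bal n u′ $ (ε · y) +ᵛ bal n v′ $ bal n ℓ $ y)
    ≡⟨ cong₂ _+ᵛ_ (sym (bal-square n left-square x)) (sym right-square) ⟩
  bal n (step ℓ′) $ bal n u $ x +ᵛ bal n (step ℓ′) $ bal n v $ y
    ≡⟨ $-+ (bal n (step ℓ′)) (bal n u $ x) _ ⟨
  bal n (step ℓ′) $ (bal n u $ x +ᵛ bal n v $ y) ∎
  where
  u  = left (suc k)
  v  = right (suc k)
  u′ = left k
  v′ = right k
  ℓ  = lowerPol ε b k
  ℓ′ = lowerPol ε b (suc k)
  x  = coords n (suc (suc k)) $ f
  y  = coords n (suc k) $ g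
  left-square : ∀ N s → step ℓ′ N s ∘ u N s ≗ u′ N s ∘ ℓ′ N s
  left-square zero    s _ = refl
  left-square (suc N) s z = cong (ℓ′ N s $ z ,_) ($-0 (ℓ′ N (suc s)))
  -- Lowering commutes with multiplication by t up to ε; this ε-term is the one that arises when the
  -- new element itself is removed.
  right-square : bal n (step ℓ′) $ bal n v $ y ≡ bal n u′ $ (ε · y) +ᵛ bal n v′ $ bal n ℓ $ y
  right-square = begin
    bal n (step ℓ′) $ bal n v $ y
      ≡⟨ bal-∘ n (step ℓ′) v y ⟩
    bal n (λ N s → step ℓ′ N s ∘ v N s) $ y
      ≡⟨ bal-cong n (λ
           { zero s z → refl
           ; (suc N) s z → cong₂ _,_ (lowerAt-shiftAt ε b k s z)
               (sym (trans (cong (_+ᵛ lowerAt ε b k s $ z) (·-zeroʳ ε)) (+ᵛ-identityˡ _))) }) y ⟩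
    bal n (λ N s → scale ε ∘ u′ N s +ₗ v′ N s ∘ ℓ N s) $ y
      ≡⟨ bal-+ n _ _ y ⟨
    bal n (λ N s → scale ε ∘ u′ N s) $ y +ᵛ bal n (λ N s → v′ N s ∘ ℓ N s) $ y
      ≡⟨ cong₂ _+ᵛ_
           (trans (bal-cong n (λ N s z → sym ($-· (u′ N s) ε z)) y)
             (trans (sym (bal-∘ n u′ (λ N s → scale ε) y)) (cong (bal n u′ $_) (bal-scale n ε y))))
           (sym (bal-∘ n v′ ℓ y)) ⟩
    bal n u′ $ (ε · y) +ᵛ bal n v′ $ bal n ℓ $ y ∎

-- Independence of the truncated coordinates

glueAt : ∀ N k s → Trunc (suc N) (suc k ∸ s) ⊕ Trunc (suc N) (k ∸ s)
                 ⇒ Trunc (suc (suc N)) (suc k ∸ s) ⊕ Trunc N (k ∸ s)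
glueAt N k       zero    = glue N k
glueAt N zero    (suc s) = 0ₗ
glueAt N (suc k) (suc s) = glueAt N k s

isIso-glueAt : ∀ N k s → IsIso (glueAt N k s)
isIso-glueAt N k       zero    = isIso-glue N k
isIso-glueAt N zero    (suc s) = isIso-trivial
  (trivial-⊕ (trivial-Tru (suc N) s) (trivial-Trunc (suc N)))
  (trivial-⊕ (trivial-Tru (suc (suc N)) s) (trivial-Trunc N))
isIso-glueAt N (suc k) (suc s) = isIso-glueAt N k s

overflowAt : ∀ N k s → Poly (suc k ∸ s) ⇒ Trunc (suc N) (k ∸ s)
overflowAt N k       zero    = overflow N k
overflowAt N zero    (suc s) = 0ₗ
overflowAt N (suc k) (suc s) = overflowAt N k s

glueAt-inl : ∀ N k s f → glueAt N k s $ (trunc (suc N) (suc k ∸ s) $ f , overflowAt N k s $ f)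
                       ≡ (trunc (suc (suc N)) (suc k ∸ s) $ f , 0ᵛ)
glueAt-inl N k       zero    f = glue-inl N k f
glueAt-inl N zero    (suc s) f = trivial-⊕ (trivial-Tru (suc (suc N)) s) (trivial-Trunc N) _ _
glueAt-inl N (suc k) (suc s) f = glueAt-inl N k s f

glueAt-inr : ∀ N k s g → glueAt N k s $ (0ᵛ , trunc (suc N) (k ∸ s) $ g)
                       ≡ (trunc (suc (suc N)) (suc k ∸ s) $ shiftAt k s $ g , trunc N (k ∸ s) $ g)
glueAt-inr N k       zero    g = glue-inr N k g
glueAt-inr N zero    (suc s) g = trivial-⊕ (trivial-Tru (suc (suc N)) s) (trivial-Trunc N) _ _
glueAt-inr N (suc k) (suc s) g = glueAt-inr N k s g

glueTru : ∀ k N s → Tru (suc k) N s ⊕ Tru k N s ⇒ Step (Tru (suc k)) N s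
glueTru k zero    s = 0ₗ
glueTru k (suc N) s = glueAt N k s

isIso-glueTru : ∀ k N s → IsIso (glueTru k N s)
isIso-glueTru k zero    s = isIso-trivial (λ _ _ → refl) (λ _ _ → refl)
isIso-glueTru k (suc N) s = isIso-glueAt N k s

overflowTru : ∀ k → Pol (suc k) ⇛ Tru k
overflowTru k zero    s = 0ₗ
overflowTru k (suc N) s = overflowAt N k s

truncPol : ∀ k → Pol k ⇛ Tru k
truncPol k N s = trunc N (k ∸ s)

-- For T of length n only the first n + 1 - 2 |T| coefficients are independent. The next one
-- depends on the others, also on those at other T, and enters the induction as a shear.
isIso-truncCoords : ∀ n k → IsIso (bal n (truncPol k) ∘ coords n k)
isIso-truncCoords zero    zero    = isIso-trivial (λ _ _ → refl) (trivial-Trunc 1)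
isIso-truncCoords zero    (suc k) = record
  { inv = outr ; inverseˡ = λ _ → refl ; inverseʳ = λ _ → refl }
isIso-truncCoords (suc n) zero    = isIso-trivial
  (trivial-Sub (suc n) (_<ᵇ 0) (λ _ → refl)) (trivial-Bal (suc n) trivial-Tru)
isIso-truncCoords (suc n) (suc k) = isIso-cong agree
  (isIso-∘ (isIso-bal-copair n (isIso-glueTru k)) (isIso-∘ (isIso-shear h) (isIso-⊕ i j)))
  where
  i = isIso-truncCoords n (suc k)
  j = isIso-truncCoords n k
  t = truncPol (suc k)
  o = overflowTru k
  h = bal n o ∘ coords n (suc k) ∘ inv i
  l = λ N s → glueTru k N s ∘ inl
  r = λ N s → glueTru k N s ∘ inr
  agree : bal-copair n (glueTru k) ∘ shear h ∘ ((bal n t ∘ coords n (suc k)) ⊕ₗ (bal n (truncPol k) ∘ coords n k))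
        ≗ bal (suc n) t ∘ coords (suc n) (suc k)
  agree (f , g) = begin
    bal n l $ bal n t $ x +ᵛ bal n r $ (h $ bal n t $ x +ᵛ bal n (truncPol k) $ y)
      ≡⟨ cong (λ z → bal n l $ bal n t $ x +ᵛ bal n r $ (bal n o $ coords n (suc k) $ z +ᵛ bal n (truncPol k) $ y))
           (inverseˡ i f) ⟩
    bal n l $ bal n t $ x +ᵛ bal n r $ (bal n o $ x +ᵛ bal n (truncPol k) $ y)
      ≡⟨ cong (bal n l $ bal n t $ x +ᵛ_) ($-+ (bal n r) (bal n o $ x) _) ⟩
    bal n l $ bal n t $ x +ᵛ (bal n r $ bal n o $ x +ᵛ bal n r $ bal n (truncPol k) $ y)
      ≡⟨ +ᵛ-assoc (bal n l $ bal n t $ x) _ _ ⟨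
    bal n l $ bal n t $ x +ᵛ bal n r $ bal n o $ x +ᵛ bal n r $ bal n (truncPol k) $ y
      ≡⟨ cong₂ _+ᵛ_ left-part right-part ⟩
    bal n (step t) $ bal n (left k) $ x +ᵛ bal n (step t) $ bal n (right k) $ y
      ≡⟨ $-+ (bal n (step t)) (bal n (left k) $ x) _ ⟨
    bal n (step t) $ (bal n (left k) $ x +ᵛ bal n (right k) $ y) ∎
    where
    x = coords n (suc k) $ f
    y = coords n k $ g
    left-leaf : ∀ N s → (l N s ∘ t N s +ₗ r N s ∘ o N s) ≗ step t N s ∘ left k N s
    left-leaf zero    s z = refl
    left-leaf (suc N) s z = begin
      glueAt N k s $ (a , 0ᵛ) +ᵛ glueAt N k s $ (0ᵛ , b)
        ≡⟨ $-+ (glueAt N k s) (a , 0ᵛ) _ ⟨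
      glueAt N k s $ (a +ᵛ 0ᵛ , 0ᵛ +ᵛ b)
        ≡⟨ cong₂ (λ a b → glueAt N k s $ (a , b)) (+ᵛ-identityʳ a) (+ᵛ-identityˡ b) ⟩
      glueAt N k s $ (a , b)
        ≡⟨ glueAt-inl N k s z ⟩
      t (suc (suc N)) s $ z , 0ᵛ
        ≡⟨ cong (t (suc (suc N)) s $ z ,_) ($-0 (t N (suc s))) ⟨
      t (suc (suc N)) s $ z , t N (suc s) $ 0ᵛ ∎
      where
      a = t (suc N) s $ z
      b = overflowAt N k s $ z
    left-part : bal n l $ bal n t $ x +ᵛ bal n r $ bal n o $ x ≡ bal n (step t) $ bal n (left k) $ x
    left-part = begin
      bal n l $ bal n t $ x +ᵛ bal n r $ bal n o $ x
        ≡⟨ cong₂ _+ᵛ_ (bal-∘ n l t x) (bal-∘ n r o x) ⟩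
      bal n (λ N s → l N s ∘ t N s) $ x +ᵛ bal n (λ N s → r N s ∘ o N s) $ x
        ≡⟨ bal-+ n _ _ x ⟩
      bal n (λ N s → l N s ∘ t N s +ₗ r N s ∘ o N s) $ x
        ≡⟨ bal-cong n left-leaf x ⟩
      bal n (λ N s → step t N s ∘ left k N s) $ x
        ≡⟨ bal-∘ n (step t) (left k) x ⟨
      bal n (step t) $ bal n (left k) $ x ∎
    right-leaf : ∀ N s → r N s ∘ truncPol k N s ≗ step t N s ∘ right k N s
    right-leaf zero    s z = refl
    right-leaf (suc N) s z = glueAt-inr N k s z
    right-part : bal n r $ bal n (truncPol k) $ y ≡ bal n (step t) $ bal n (right k) $ y
    right-part = bal-square n right-leaf y

-- 2 k ≤ N + 2 s + 1 ≤ 2 (N + s) + 1, and by parity k ≤ N + s. In particular a non-ballot T, with N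
-- = 0, carries only the zero polynomial.
∸-bound : ∀ n k N s → 2 ℕ.* k ≤ 2 ℕ.+ n → N ℕ.+ 2 ℕ.* s ≡ suc n → k ∸ s ≤ N
∸-bound n k N s 2k≤ eq = ℕ.m≤n+o⇒m∸n≤o k s
  (subst (k ≤_) (ℕ.+-comm N s) (ℕ.≤-pred (ℕ.*-cancelˡ-< 2 k (suc (N ℕ.+ s)) bound)))
  where
  bound : 2 ℕ.* k ℕ.< 2 ℕ.* suc (N ℕ.+ s)
  bound = ℕ.≤-trans
    (s≤s (ℕ.≤-trans 2k≤ (ℕ.≤-reflexive (cong suc (sym eq)))))
    (ℕ.≤-trans (ℕ.+-monoʳ-≤ 2 (ℕ.+-monoˡ-≤ (2 ℕ.* s) (ℕ.m≤n*m N 2)))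
      (ℕ.≤-reflexive (trans (cong (2 ℕ.+_) (sym (ℕ.*-distribˡ-+ 2 N s))) (sym (ℕ.*-suc 2 (N ℕ.+ s))))))

-- Within the bound every truncation is an isomorphism and can be cancelled from
-- `isIso-truncCoords`.
isIso-coords : ∀ n k → 2 ℕ.* k ≤ 2 ℕ.+ n → IsIso (coords n k)
isIso-coords n k 2k≤ = isIso-cancelˡ
  (isIso-bal n λ N s eq → isIso-trunc N (k ∸ s) (∸-bound n k N s 2k≤ eq))
  (isIso-truncCoords n k)

lowerAt-expand : ∀ k s → lowerAt 1ℤ (+ 2) k s ∘ expand (suc k ∸ s) ≗ expand (k ∸ s) ∘ lowerAt 0ℤ (+ 1) k s
lowerAt-expand k       zero    = lower-expand k
lowerAt-expand zero    (suc s) = λ _ → refl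
lowerAt-expand (suc k) (suc s) = lowerAt-expand k s

lowOp-∼ : ∀ n k → 2 ℕ.* k ≤ n → lowOp 1ℤ (+ 2) n k ∼ lowOp 0ℤ (+ 1) n k
lowOp-∼ n k 2k≤n = ∼-trans (to-bal 1ℤ (+ 2)) (∼-trans (∼-sym leaves) (∼-sym (to-bal 0ℤ (+ 1))))
  where
  to-bal : ∀ ε b → lowOp ε b n k ∼ bal n (lowerPol ε b k)
  to-bal ε b = record
    -- The source consists of the degrees below k + 1, for which the bound reads 2 (k + 1) ≤ 2 + n.
    -- It is attained at the middle degree, n = 2 k.
    { domIso = isIso-coords n (suc k) (subst (_≤ 2 ℕ.+ n) (sym (ℕ.*-suc 2 k)) (s≤s (s≤s 2k≤n)))
    ; codIso = isIso-coords n k (ℕ.≤-trans 2k≤n (ℕ.m≤n+m n 2))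
    ; square = coords-lowOp ε b n k }
  leaves : bal n (lowerPol 0ℤ (+ 1) k) ∼ bal n (lowerPol 1ℤ (+ 2) k)
  leaves = record
    { domIso = isIso-bal n λ N s _ → isIso-expand (suc k ∸ s)
    ; codIso = isIso-bal n λ N s _ → isIso-expand (k ∸ s)
    ; square = bal-square n λ N s z → sym (lowerAt-expand k s z) }

-- Splitting at the middle degree

mask : ∀ n p → F n ⇒ F n
mask n p = incl n p ∘ incl n p ᵀ

mask-cong : ∀ n {p q} → (∀ l → p l ≡ q l) → mask n p ≗ mask n q
mask-cong zero    eq x       = cong (λ b → bit b $ adj (bit b) x) (eq 0)
mask-cong (suc n) eq (x , y) = cong₂ _,_ (mask-cong n eq x) (mask-cong n (eq Fun.∘ suc) y)

mask-complement : ∀ n p x → mask n p $ x +ᵛ mask n (not Fun.∘ p) $ x ≡ x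
mask-complement zero p x with p 0
... | true  = +ᵛ-identityʳ x
... | false = +ᵛ-identityˡ x
mask-complement (suc n) p (x , y) = cong₂ _,_ (mask-complement n p x) (mask-complement n (p Fun.∘ suc) y)

restrict-not : ∀ n p → incl n (not Fun.∘ p) ᵀ ∘ incl n p ≗ 0ₗ
restrict-not zero p x with p 0
... | true  = refl
... | false = refl
restrict-not (suc n) p (x , y) = cong₂ _,_ (restrict-not n p x) (restrict-not n (p Fun.∘ suc) y)

split : ∀ n p → F n ⇒ Sub n p ⊕ Sub n (not Fun.∘ p)
split n p = pair (incl n p ᵀ) (incl n (not Fun.∘ p) ᵀ)

isIso-split : ∀ n p → IsIso (split n p)
isIso-split n p = record
  { inv = copair ι κ
  ; inverseˡ = mask-complement n p
  ; inverseʳ = λ (x , y) → cong₂ _,_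
      (trans ($-+ (ι ᵀ) (ι $ x) (κ $ y)) (trans
        (cong₂ _+ᵛ_ (restrict-incl n p x) (ᵀ-cong {f = κ ᵀ ∘ ι} {0ₗ} (restrict-not n p) y)) (+ᵛ-identityʳ x)))
      (trans ($-+ (κ ᵀ) (ι $ x) (κ $ y)) (trans
        (cong₂ _+ᵛ_ (restrict-not n p x) (restrict-incl n _ y)) (+ᵛ-identityˡ y))) }
  where
  ι = incl n p
  κ = incl n (not Fun.∘ p)

-- One equation says both that f carries the degrees in p to those in q and that it carries the
-- other degrees to the others.
Intertwines : ∀ {n} → F n ⇒ F n → (p q : ℕ → Bool) → Set
Intertwines {n} f p q = f ∘ mask n p ≗ mask n q ∘ f

restrict-intertwine : ∀ {n} (f : F n ⇒ F n) {p q} → Intertwines f p q →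
  ∀ x → incl n q ᵀ $ f $ mask n p $ x ≡ incl n q ᵀ $ f $ x
restrict-intertwine {n} f {p} {q} i x =
  trans (cong (incl n q ᵀ $_) (i x)) (restrict-incl n q (incl n q ᵀ $ f $ x))

∼-split : ∀ {n} (f : F n ⇒ F n) p q → Intertwines f p q → Intertwines f (not Fun.∘ p) (not Fun.∘ q) →
  f ∼ block p q f ⊕ₗ block (not Fun.∘ p) (not Fun.∘ q) f
∼-split {n} f p q i j = record
  { domIso = isIso-split n p
  ; codIso = isIso-split n q
  ; square = λ x → cong₂ _,_ (sym (restrict-intertwine f i x)) (sym (restrict-intertwine f j x)) }

isIso-block : ∀ {n} {f : F n ⇒ F n} {p q} → IsIso f → Intertwines f p q → IsIso (block p q f)
isIso-block {n} {f} {p} {q} i t = record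
  { inv = block q p (inv i)
  ; inverseˡ = λ x → begin
      incl n p ᵀ $ inv i $ mask n q $ f $ incl n p $ x
        ≡⟨ restrict-intertwine (inv i) t′ (f $ incl n p $ x) ⟩
      incl n p ᵀ $ inv i $ f $ incl n p $ x
        ≡⟨ cong (incl n p ᵀ $_) (inverseˡ i _) ⟩
      incl n p ᵀ $ incl n p $ x
        ≡⟨ restrict-incl n p x ⟩
      x ∎
  ; inverseʳ = λ x → begin
      incl n q ᵀ $ f $ mask n p $ inv i $ incl n q $ x
        ≡⟨ restrict-intertwine f t (inv i $ incl n q $ x) ⟩
      incl n q ᵀ $ f $ inv i $ incl n q $ x
        ≡⟨ cong (incl n q ᵀ $_) (inverseʳ i _) ⟩
      incl n q ᵀ $ incl n q $ x
        ≡⟨ restrict-incl n q x ⟩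
      x ∎ }
  where
  t′ : Intertwines (inv i) q p
  t′ x = begin
    inv i $ mask n q $ x                  ≡⟨ cong (λ y → inv i $ mask n q $ y) (inverseʳ i x) ⟨
    inv i $ mask n q $ f $ inv i $ x      ≡⟨ cong (inv i $_) (t (inv i $ x)) ⟨
    inv i $ f $ mask n p $ inv i $ x      ≡⟨ inverseˡ i _ ⟩
    mask n p $ inv i $ x                  ∎

-- The lowering term goes from degree l + 1 to l, whence the first condition. The diagonal term
-- stays in degree l, so p and q have to agree there unless its coefficient b (c - l) vanishes.
op-intertwines : ∀ ε b n c p q → (∀ l → q l ≡ p (suc l)) → (∀ l → p l ≡ q l ⊎ c ≡ + l) →
  Intertwines (op ε b n c) p q
op-intertwines ε b zero c p q _ eq x with eq 0
... | inj₁ p≡q = begin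
  b ℤ.* c ℤ.* (bit (p 0) $ adj (bit (p 0)) x)
    ≡⟨ cong (λ a → b ℤ.* c ℤ.* (bit a $ adj (bit a) x)) p≡q ⟩
  b ℤ.* c ℤ.* (mask 0 q $ x)
    ≡⟨ $-· (mask 0 q) (b ℤ.* c) x ⟨
  mask 0 q $ (b ℤ.* c ℤ.* x) ∎
... | inj₂ refl = begin
  b ℤ.* 0ℤ ℤ.* (mask 0 p $ x)  ≡⟨ cong (ℤ._* (mask 0 p $ x)) (ℤ.*-zeroʳ b) ⟩
  0ℤ                       ≡⟨ $-0 (mask 0 q) ⟨
  mask 0 q $ 0ℤ            ≡⟨ cong (λ a → mask 0 q $ (a ℤ.* x)) (ℤ.*-zeroʳ b) ⟨
  mask 0 q $ (b ℤ.* 0ℤ ℤ.* x)  ∎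
op-intertwines ε b (suc n) c p q q≡ eq (f , g) = cong₂ _,_
  (begin
    op ε b n c $ mask n p $ f +ᵛ ε · mask n (p Fun.∘ suc) $ g
      ≡⟨ cong₂ _+ᵛ_ (op-intertwines ε b n c p q q≡ eq f)
           (trans (cong (ε ·_) (sym (mask-cong n q≡ g))) (sym ($-· (mask n q) ε g))) ⟩
    mask n q $ op ε b n c $ f +ᵛ mask n q $ (ε · g)
      ≡⟨ $-+ (mask n q) (op ε b n c $ f) _ ⟨
    mask n q $ (op ε b n c $ f +ᵛ ε · g) ∎)
  (op-intertwines ε b n (pred c) (p Fun.∘ suc) (q Fun.∘ suc) (q≡ Fun.∘ suc) eq′ g)
  where
  eq′ : ∀ l → p (suc l) ≡ q (suc l) ⊎ pred c ≡ + l
  eq′ l with eq (suc l)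
  ... | inj₁ p≡q = inj₁ p≡q
  ... | inj₂ c≡l = inj₂ (cong pred c≡l)

-- Signed complementation of subsets

negate-iso : IsIso (scale {A} -1ℤ)
negate-iso = record { inv = scale -1ℤ ; inverseˡ = law ; inverseʳ = law }
  where
  law : ∀ {A} (x : ⟦ A ⟧) → -1ℤ · -1ℤ · x ≡ x
  law x = trans (sym (·-assoc -1ℤ -1ℤ x)) (·-identityˡ x)

-- t_S ↦ ± t_{complement of S}, with signs chosen so that op-flip holds
flip : ∀ n → F n ⇒ F n
flip zero    = idₗ
flip (suc n) = (flip n ⊕ₗ scale -1ℤ ∘ flip n) ∘ pair outr outl

isIso-flip : ∀ n → IsIso (flip n)
isIso-flip zero    = isIso-id
isIso-flip (suc n) = isIso-∘ (isIso-⊕ (isIso-flip n) (isIso-∘ negate-iso (isIso-flip n))) record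
  { inv = pair outr outl ; inverseˡ = λ _ → refl ; inverseʳ = λ _ → refl }

flip-intertwines : ∀ n p q → (∀ l l′ → l ℕ.+ l′ ≡ n → q l ≡ p l′) → Intertwines (flip n) p q
flip-intertwines zero    p q eq x       = cong (λ b → bit b $ adj (bit b) x) (sym (eq 0 0 refl))
flip-intertwines (suc n) p q eq (f , g) = cong₂ _,_
  (flip-intertwines n (p Fun.∘ suc) q (λ l l′ e → eq l (suc l′) (trans (ℕ.+-suc l l′) (cong suc e))) g)
  (trans (cong (-1ℤ ·_) (flip-intertwines n p (q Fun.∘ suc) (λ l l′ e → eq (suc l) l′ (cong suc e)) f))
    (sym ($-· (mask n (q Fun.∘ suc)) -1ℤ (flip n $ f))))

-- Complementation exchanges removing and adjoining an element, and turns c - |S| into c - n + |S| =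
-- -(c′ - |S|). The sign of `flip` alternates with the degree, so the lowering term gets the same
-- minus. Two constants are needed because each component of the recursion lowers only one of them.
op-flip : ∀ ε b n c c′ → c + c′ ≡ + n → op ε b n c ∘ flip n ≗ scale -1ℤ ∘ flip n ∘ op ε b n c′ ᵀ
op-flip ε b zero c c′ eq x = begin
  b ℤ.* c ℤ.* x             ≡⟨ cong (λ a → b ℤ.* a ℤ.* x) (c≡-c′ c c′) ⟩
  b ℤ.* (c + c′ - c′) ℤ.* x ≡⟨ cong (λ a → b ℤ.* (a - c′) ℤ.* x) eq ⟩
  b ℤ.* (0ℤ - c′) ℤ.* x     ≡⟨ negate b c′ x ⟩
  -1ℤ ℤ.* (b ℤ.* c′ ℤ.* x)    ∎
  where
  c≡-c′ : ∀ c c′ → c ≡ c + c′ - c′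
  c≡-c′ = solve-∀
  negate : ∀ b c x → b ℤ.* (0ℤ - c) ℤ.* x ≡ -1ℤ ℤ.* (b ℤ.* c ℤ.* x)
  negate = solve-∀
op-flip ε b (suc n) c c′ eq (f , g) = cong₂ _,_
  (begin
    op ε b n c $ flip n $ g +ᵛ ε · -1ℤ · flip n $ f
      ≡⟨ cong₂ _+ᵛ_ (op-flip ε b n c (pred c′) (pred-eq c c′ eq) g)
           (trans (sym (·-assoc ε -1ℤ _)) (trans (cong (_· flip n $ f) (ℤ.*-comm ε -1ℤ)) (·-assoc -1ℤ ε _))) ⟩
    -1ℤ · flip n $ adj (op ε b n (pred c′)) g +ᵛ -1ℤ · ε · flip n $ f
      ≡⟨ ·-distribˡ -1ℤ (flip n $ adj (op ε b n (pred c′)) g) _ ⟨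
    -1ℤ · (flip n $ adj (op ε b n (pred c′)) g +ᵛ ε · flip n $ f)
      ≡⟨ cong (-1ℤ ·_) (trans (+ᵛ-comm (flip n $ adj (op ε b n (pred c′)) g) _) (trans
           (cong (_+ᵛ _) (sym ($-· (flip n) ε f))) (sym ($-+ (flip n) (ε · f) _)))) ⟩
    -1ℤ · flip n $ (ε · f +ᵛ adj (op ε b n (pred c′)) g) ∎)
  (begin
    op ε b n (pred c) $ (-1ℤ · flip n $ f)
      ≡⟨ $-· (op ε b n (pred c)) -1ℤ _ ⟩
    -1ℤ · op ε b n (pred c) $ flip n $ f
      ≡⟨ cong (-1ℤ ·_) (op-flip ε b n (pred c) c′
           (trans (ℤ.+-comm (pred c) c′) (pred-eq c′ c (trans (ℤ.+-comm c′ c) eq))) f) ⟩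
    -1ℤ · -1ℤ · flip n $ adj (op ε b n c′) f
      ≡⟨ cong (λ z → -1ℤ · -1ℤ · flip n $ z) (+ᵛ-identityʳ _) ⟨
    -1ℤ · -1ℤ · flip n $ (adj (op ε b n c′) f +ᵛ 0ᵛ) ∎)
  where
  pred-eq : ∀ c c′ → c + c′ ≡ + suc n → c + pred c′ ≡ + n
  pred-eq c c′ eq = trans (move c c′) (cong pred eq)
    where
    move : ∀ c c′ → c + (-1ℤ + c′) ≡ -1ℤ + (c + c′)
    move = solve-∀

not-<ᵇ : ∀ m m′ l l′ → l ℕ.+ l′ ≡ m ℕ.+ m′ → not (l <ᵇ suc m) ≡ (l′ <ᵇ m′)
not-<ᵇ m       m′ zero    l′ refl = sym (false-<ᵇ m m′)
  where
  false-<ᵇ : ∀ m n → (m ℕ.+ n <ᵇ n) ≡ false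
  false-<ᵇ m zero    = refl
  false-<ᵇ m (suc n) = trans (cong (_<ᵇ suc n) (ℕ.+-suc m n)) (false-<ᵇ m n)
not-<ᵇ zero    m′ (suc l) l′ refl = sym (true-<ᵇ l l′)
  where
  true-<ᵇ : ∀ m n → (n <ᵇ suc (m ℕ.+ n)) ≡ true
  true-<ᵇ m zero    = refl
  true-<ᵇ m (suc n) = trans (cong (n <ᵇ_) (ℕ.+-suc m n)) (true-<ᵇ m n)
not-<ᵇ (suc m) m′ (suc l) l′ eq   = not-<ᵇ m m′ l l′ (ℕ.suc-injective eq)

<ᵇ-suc : ∀ m l → (l <ᵇ suc m) ≡ (l <ᵇ m) ⊎ + m ≡ + l
<ᵇ-suc zero    zero    = inj₂ refl
<ᵇ-suc zero    (suc l) = inj₁ refl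
<ᵇ-suc (suc m) zero    = inj₁ refl
<ᵇ-suc (suc m) (suc l) with <ᵇ-suc m l
... | inj₁ eq = inj₁ eq
... | inj₂ eq = inj₂ (cong (λ i → 1ℤ + i) eq)

module _ (m : ℕ) where

  private
    n = m ℕ.+ m
    p q p̄ q̄ : ℕ → Bool
    p l = l <ᵇ suc m
    q l = l <ᵇ m
    p̄ l = not (p l)
    q̄ l = not (q l)

  flip-low : Intertwines (flip n) q p̄
  flip-low = flip-intertwines n q p̄ (not-<ᵇ m m)

  flip-high : Intertwines (flip n) p q̄
  flip-high = flip-intertwines n p q̄ λ l l′ eq →
    trans (cong not (sym (not-<ᵇ m m l′ l (trans (ℕ.+-comm l′ l) eq)))) (Bool.not-involutive (p l′))

  module _ (ε b : ℤ) where

    private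
      O = op ε b n (+ m)
      X = lowOp ε b n m

    O-low : Intertwines O p q
    O-low = op-intertwines ε b n (+ m) p q (λ _ → refl) (<ᵇ-suc m)

    O-high : Intertwines O p̄ q̄
    O-high = op-intertwines ε b n (+ m) p̄ q̄ (λ _ → refl) λ l → high l (<ᵇ-suc m l)
      where
      high : ∀ l → p l ≡ q l ⊎ + m ≡ + l → p̄ l ≡ q̄ l ⊎ + m ≡ + l
      high l (inj₁ eq) = inj₁ (cong not eq)
      high l (inj₂ eq) = inj₂ eq

    -- This is `op-flip` with both constants equal to m, which is possible as n = m + m.
    -- Complementation carries degrees < m to degrees > m and degrees ≤ m to degrees ≥ m.
    high-∼ : scale -1ℤ ∘ X ᵀ ∼ block p̄ q̄ O
    high-∼ = record
      { domIso = isIso-block (isIso-flip n) flip-low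
      ; codIso = isIso-block (isIso-flip n) flip-high
      ; square = λ y → begin
          block p q̄ (flip n) $ (-1ℤ · adj X y)
            ≡⟨ $-· (block p q̄ (flip n)) -1ℤ (adj X y) ⟩
          -1ℤ · incl n q̄ ᵀ $ flip n $ mask n p $ O ᵀ $ incl n q $ y
            ≡⟨ cong (-1ℤ ·_) (restrict-intertwine (flip n) flip-high (adj O (incl n q $ y))) ⟩
          -1ℤ · incl n q̄ ᵀ $ flip n $ O ᵀ $ incl n q $ y
            ≡⟨ $-· (incl n q̄ ᵀ) -1ℤ (flip n $ adj O (incl n q $ y)) ⟨
          incl n q̄ ᵀ $ (-1ℤ · flip n $ O ᵀ $ incl n q $ y)
            ≡⟨ cong (incl n q̄ ᵀ $_) (op-flip ε b n (+ m) (+ m) refl (incl n q $ y)) ⟨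
          incl n q̄ ᵀ $ O $ flip n $ incl n q $ y
            ≡⟨ restrict-intertwine O O-high (flip n $ incl n q $ y) ⟨
          incl n q̄ ᵀ $ O $ mask n p̄ $ flip n $ incl n q $ y ∎ }

    op-split : O ∼ X ⊕ₗ scale -1ℤ ∘ X ᵀ
    op-split = ∼-trans (∼-split O p q O-low O-high) (∼-⊕ (∼-refl X) (∼-sym high-∼))

  op-∼ : op 1ℤ (+ 2) n (+ m) ∼ op 0ℤ (+ 1) n (+ m)
  op-∼ = ∼-trans (op-split 1ℤ (+ 2)) (∼-trans
    (∼-⊕ low (∼-scale -1ℤ (∼-sym (∼-ᵀ low))))
    (∼-sym (op-split 0ℤ (+ 1))))
    where
    low = lowOp-∼ n m (ℕ.≤-reflexive (cong (m ℕ.+_) (ℕ.+-identityʳ m)))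

-- The adjacency operator

adjacency : ∀ n → F n ⇒ F n
adjacency zero    = 0ₗ
adjacency (suc n) = pair (copair (adjacency n) idₗ) (copair idₗ (adjacency n))

-- From the values of a function on the cube to its coefficients with respect to the monomials t_S
monomial : ∀ n → F n ⇒ F n
monomial zero    = idₗ
monomial (suc n) = shear (scale -1ℤ) ∘ (monomial n ⊕ₗ monomial n)

isIso-monomial : ∀ n → IsIso (monomial n)
isIso-monomial zero    = isIso-id
isIso-monomial (suc n) = isIso-∘ (isIso-shear (scale -1ℤ)) (isIso-⊕ (isIso-monomial n) (isIso-monomial n))

-- In one coordinate the swap of values sends 1 to 1 and t to 1 - t, so t_S receives the coefficient
-- n - 2 |S|. The defect e = 2 c - n is zero in the application, but the recursion moves it by +1 on
-- the first half and by -1 on the second.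
op-monomial : ∀ n c e → + 2 ℤ.* c ≡ e + + n → ∀ x →
  op 1ℤ (+ 2) n c $ monomial n $ x ≡ monomial n $ adjacency n $ x +ᵛ e · monomial n $ x
op-monomial zero c e eq x = begin
  + 2 ℤ.* c ℤ.* x     ≡⟨ cong (ℤ._* x) (trans eq (ℤ.+-identityʳ e)) ⟩
  e ℤ.* x           ≡⟨ ℤ.+-identityˡ (e ℤ.* x) ⟨
  0ℤ + e ℤ.* x      ∎
op-monomial (suc n) c e eq (f , g) = cong₂ _,_
  (begin
    O c $ T $ f +ᵛ 1ℤ · (-1ℤ · T $ f +ᵛ T $ g)
      ≡⟨ cong (_+ᵛ 1ℤ · (-1ℤ · T $ f +ᵛ T $ g)) (op-monomial n c (e + 1ℤ) (trans eq (up e (+ n))) f) ⟩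
    T $ G $ f +ᵛ (e + 1ℤ) · T $ f +ᵛ 1ℤ · (-1ℤ · T $ f +ᵛ T $ g)
      ≡⟨ first (T $ G $ f) (T $ f) (T $ g) ⟩
    T $ G $ f +ᵛ T $ g +ᵛ e · T $ f
      ≡⟨ cong (_+ᵛ e · T $ f) ($-+ T (G $ f) g) ⟨
    T $ (G $ f +ᵛ g) +ᵛ e · T $ f ∎)
  (begin
    O (pred c) $ (-1ℤ · T $ f +ᵛ T $ g)
      ≡⟨ trans ($-+ (O (pred c)) (-1ℤ · T $ f) _)
           (cong (_+ᵛ O (pred c) $ T $ g) ($-· (O (pred c)) -1ℤ (T $ f))) ⟩
    -1ℤ · O (pred c) $ T $ f +ᵛ O (pred c) $ T $ g
      ≡⟨ cong₂ (λ u v → -1ℤ · u +ᵛ v) (down-law f) (down-law g) ⟩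
    -1ℤ · (T $ G $ f +ᵛ (e - 1ℤ) · T $ f) +ᵛ (T $ G $ g +ᵛ (e - 1ℤ) · T $ g)
      ≡⟨ second (T $ G $ f) (T $ f) (T $ G $ g) (T $ g) ⟩
    -1ℤ · (T $ G $ f +ᵛ T $ g) +ᵛ (T $ f +ᵛ T $ G $ g) +ᵛ e · (-1ℤ · T $ f +ᵛ T $ g)
      ≡⟨ cong (_+ᵛ e · (-1ℤ · T $ f +ᵛ T $ g))
           (cong₂ (λ u v → -1ℤ · u +ᵛ v) ($-+ T (G $ f) g) ($-+ T f (G $ g))) ⟨
    -1ℤ · T $ (G $ f +ᵛ g) +ᵛ T $ (f +ᵛ G $ g) +ᵛ e · (-1ℤ · T $ f +ᵛ T $ g) ∎)
  where
  O = op 1ℤ (+ 2) n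
  T = monomial n
  G = adjacency n
  up : ∀ e n → e + (1ℤ + n) ≡ e + 1ℤ + n
  up = solve-∀
  down : ∀ c e n → e + (1ℤ + n) - + 2 ≡ e - 1ℤ + n
  down = solve-∀
  double-pred : ∀ c → + 2 ℤ.* (-1ℤ + c) ≡ + 2 ℤ.* c - + 2
  double-pred = solve-∀
  down-law : ∀ x → O (pred c) $ T $ x ≡ T $ G $ x +ᵛ (e - 1ℤ) · T $ x
  down-law = op-monomial n (pred c) (e - 1ℤ)
    (trans (double-pred c) (trans (cong (_- + 2) eq) (down c e (+ n))))
  first : ∀ {V} (a f g : ⟦ V ⟧) → a +ᵛ (e + 1ℤ) · f +ᵛ 1ℤ · (-1ℤ · f +ᵛ g) ≡ a +ᵛ g +ᵛ e · f
  first {𝟘}     _ _ _ = refl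
  first {𝟙}     a f g = ring-law e a f g
    where
    ring-law : ∀ e a f g → a + (e + 1ℤ) ℤ.* f + 1ℤ ℤ.* (-1ℤ ℤ.* f + g) ≡ a + g + e ℤ.* f
    ring-law = solve-∀
  first {V ⊕ W} (a , a′) (f , f′) (g , g′) = cong₂ _,_ (first a f g) (first a′ f′ g′)
  second : ∀ {V} (a f b g : ⟦ V ⟧) →
    -1ℤ · (a +ᵛ (e - 1ℤ) · f) +ᵛ (b +ᵛ (e - 1ℤ) · g) ≡ -1ℤ · (a +ᵛ g) +ᵛ (f +ᵛ b) +ᵛ e · (-1ℤ · f +ᵛ g)
  second {𝟘}     _ _ _ _ = refl
  second {𝟙}     a f b g = ring-law e a f b g
    where
    ring-law : ∀ e a f b g →
      -1ℤ ℤ.* (a + (e - 1ℤ) ℤ.* f) + (b + (e - 1ℤ) ℤ.* g) ≡ -1ℤ ℤ.* (a + g) + (f + b) + e ℤ.* (-1ℤ ℤ.* f + g)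
    ring-law = solve-∀
  second {V ⊕ W} (a , a′) (f , f′) (b , b′) (g , g′) = cong₂ _,_ (second a f b g) (second a′ f′ b′ g′)

adjacency-∼ : ∀ m → adjacency (m ℕ.+ m) ∼ op 1ℤ (+ 2) (m ℕ.+ m) (+ m)
adjacency-∼ m = record
  { domIso = isIso-monomial n
  ; codIso = isIso-monomial n
  ; square = λ x → sym (trans (op-monomial n (+ m) 0ℤ (double (+ m)) x)
      (trans (cong (monomial n $ adjacency n $ x +ᵛ_) (·-zeroˡ (monomial n $ x))) (+ᵛ-identityʳ _))) }
  where
  n = m ℕ.+ m
  double : ∀ m → + 2 ℤ.* m ≡ 0ℤ + (m + m)
  double = solve-∀

-- Diagonal operators constant on each degree

level : ∀ n → (ℕ → ℤ) → ⟦ F n ⟧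
level zero    φ = φ 0
level (suc n) φ = level n φ , level n (φ Fun.∘ suc)

diag : ∀ n → ⟦ F n ⟧ → F n ⇒ F n
diag zero    d        = scale d
diag (suc n) (d , d′) = diag n d ⊕ₗ diag n d′

diag-level-cong : ∀ n {φ ψ} → (∀ l → φ l ≡ ψ l) → diag n (level n φ) ≗ diag n (level n ψ)
diag-level-cong zero    eq x       = cong (ℤ._* x) (eq 0)
diag-level-cong (suc n) eq (x , y) =
  cong₂ _,_ (diag-level-cong n eq x) (diag-level-cong n (eq Fun.∘ suc) y)

diag-level-1 : ∀ n → diag n (level n λ _ → 1ℤ) ≗ idₗ
diag-level-1 zero    x       = ℤ.*-identityˡ x
diag-level-1 (suc n) (x , y) = cong₂ _,_ (diag-level-1 n x) (diag-level-1 n y)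

diag-level-* : ∀ n φ ψ → diag n (level n φ) ∘ diag n (level n ψ) ≗ diag n (level n λ l → φ l ℤ.* ψ l)
diag-level-* zero    φ ψ x       = sym (ℤ.*-assoc (φ 0) (ψ 0) x)
diag-level-* (suc n) φ ψ (x , y) =
  cong₂ _,_ (diag-level-* n φ ψ x) (diag-level-* n (φ Fun.∘ suc) (ψ Fun.∘ suc) y)

op-diag : ∀ n c → op 0ℤ 1ℤ n c ≗ diag n (level n λ l → c - + l)
op-diag zero    c x       = cong (ℤ._* x) (trans (ℤ.*-identityˡ c) (sym (ℤ.+-identityʳ c)))
op-diag (suc n) c (f , g) = cong₂ _,_
  (trans (cong (op 0ℤ 1ℤ n c $ f +ᵛ_) (·-zeroˡ g)) (trans (+ᵛ-identityʳ _) (op-diag n c f)))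
  (trans (op-diag n (pred c) g) (diag-level-cong n (λ l → move c (+ l)) g))
  where
  move : ∀ c l → -1ℤ + c - l ≡ c - (1ℤ + l)
  move = solve-∀

sgn : ℕ → ℕ → ℤ
sgn m       zero    = 1ℤ
sgn zero    (suc l) = -1ℤ
sgn (suc m) (suc l) = sgn m l

sgn-* : ∀ m l → sgn m l ℤ.* (+ m - + l) ≡ + ∣ m - l ∣
sgn-* zero    zero    = refl
sgn-* (suc m) zero    = trans (ℤ.*-identityˡ (+ suc m - 0ℤ)) (ℤ.+-identityʳ (+ suc m))
sgn-* zero    (suc l) = cong (+_) (cong suc (ℕ.+-identityʳ l))
sgn-* (suc m) (suc l) = trans (cong (sgn m l ℤ.*_) (cancel (+ m) (+ l))) (sgn-* m l)
  where
  cancel : ∀ m l → 1ℤ + m - (1ℤ + l) ≡ m - l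
  cancel = solve-∀

sgn-sgn : ∀ m l → sgn m l ℤ.* sgn m l ≡ 1ℤ
sgn-sgn m       zero    = refl
sgn-sgn zero    (suc l) = refl
sgn-sgn (suc m) (suc l) = sgn-sgn m l

-- Signs depending on the degree form an involution, so they can be corrected on the target alone.
op-∼-diag : ∀ n m → op 0ℤ 1ℤ n (+ m) ∼ diag n (level n λ l → + ∣ m - l ∣)
op-∼-diag n m = record
  { cod = S
  ; domIso = isIso-id
  ; codIso = record { inv = S ; inverseˡ = S-involutive ; inverseʳ = S-involutive }
  ; square = λ x → begin
      S $ op 0ℤ 1ℤ n (+ m) $ x
        ≡⟨ cong (S $_) (op-diag n (+ m) x) ⟩
      S $ diag n (level n λ l → + m - + l) $ x
        ≡⟨ diag-level-* n (sgn m) _ x ⟩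
      diag n (level n λ l → sgn m l ℤ.* (+ m - + l)) $ x
        ≡⟨ diag-level-cong n (sgn-* m) x ⟩
      diag n (level n λ l → + ∣ m - l ∣) $ x ∎ }
  where
  S = diag n (level n (sgn m))
  S-involutive : S ∘ S ≗ idₗ
  S-involutive x = trans (diag-level-* n (sgn m) (sgn m) x)
    (trans (diag-level-cong n (sgn-sgn m) x) (diag-level-1 n x))

adjacency-∼-diag : ∀ m → adjacency (m ℕ.+ m) ∼ diag (m ℕ.+ m) (level (m ℕ.+ m) λ l → + ∣ m - l ∣)
adjacency-∼-diag m = ∼-trans (adjacency-∼ m) (∼-trans (op-∼ m) (op-∼-diag (m ℕ.+ m) m))

-- Matrices with respect to an ordering of the vertices

at : ∀ {n} → ⟦ F n ⟧ → Vec (Fin 2) n → ℤ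
at x       []             = x
at (x , y) (zero ∷ v)     = at x v
at (x , y) (suc zero ∷ v) = at y v

unit : ∀ {n} → Vec (Fin 2) n → ⟦ F n ⟧
unit []             = 1ℤ
unit (zero ∷ v)     = unit v , 0ᵛ
unit (suc zero ∷ v) = 0ᵛ , unit v

at-0 : ∀ {n} (v : Vec (Fin 2) n) → at 0ᵛ v ≡ 0ℤ
at-0 []             = refl
at-0 (zero ∷ v)     = at-0 v
at-0 (suc zero ∷ v) = at-0 v

at-+ : ∀ {n} x y (v : Vec (Fin 2) n) → at (x +ᵛ y) v ≡ at x v + at y v
at-+ x       y         []             = refl
at-+ (x , _) (y , _)   (zero ∷ v)     = at-+ x y v
at-+ (_ , x) (_ , y)   (suc zero ∷ v) = at-+ x y v

at-· : ∀ {n} c x (v : Vec (Fin 2) n) → at (c · x) v ≡ c ℤ.* at x v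
at-· c x       []             = refl
at-· c (x , _) (zero ∷ v)     = at-· c x v
at-· c (_ , x) (suc zero ∷ v) = at-· c x v

⟨∣unit⟩ : ∀ {n} x (v : Vec (Fin 2) n) → ⟨ x ∣ unit v ⟩ ≡ at x v
⟨∣unit⟩ x       []             = ℤ.*-identityʳ x
⟨∣unit⟩ (x , y) (zero ∷ v)     = trans (cong₂ _+_ (⟨∣unit⟩ x v) (⟨⟩-0ʳ y)) (ℤ.+-identityʳ _)
⟨∣unit⟩ (x , y) (suc zero ∷ v) = trans (cong₂ _+_ (⟨⟩-0ʳ x) (⟨∣unit⟩ y v)) (ℤ.+-identityˡ _)

indicator : Bool → ℤ
indicator b = if b then 1ℤ else 0ℤ

_≟ᵛ_ : ∀ {n} (u v : Vec (Fin 2) n) → Dec (u ≡ v)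
_≟ᵛ_ = Vec.≡-dec Fin._≟_

at-unit : ∀ {n} (u v : Vec (Fin 2) n) → at (unit v) u ≡ indicator (does (u ≟ᵛ v))
at-unit []             []             = refl
at-unit (zero ∷ u)     (zero ∷ v)     = at-unit u v
at-unit (zero ∷ u)     (suc zero ∷ v) = at-0 u
at-unit (suc zero ∷ u) (zero ∷ v)     = at-0 u
at-unit (suc zero ∷ u) (suc zero ∷ v) = at-unit u v

at-diag : ∀ {n} d x (v : Vec (Fin 2) n) → at (diag n d $ x) v ≡ at d v ℤ.* at x v
at-diag d       x       []             = refl
at-diag (d , _) (x , _) (zero ∷ v)     = at-diag d x v
at-diag (_ , d) (_ , x) (suc zero ∷ v) = at-diag d x v

-- This makes sums independent of the ordering: both sides of `∑-at` are linear in y, and at a unit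
-- vector only one summand survives.
functional-unique : ∀ n (ψ : ⟦ F n ⟧ → ℤ) x →
  (∀ y z → ψ (y +ᵛ z) ≡ ψ y + ψ z) → (∀ c y → ψ (c · y) ≡ c ℤ.* ψ y) →
  (∀ v → ψ (unit v) ≡ at x v) → ∀ y → ψ y ≡ ⟨ x ∣ y ⟩
functional-unique zero ψ x ψ-+ ψ-· eq y = begin
  ψ y          ≡⟨ cong ψ (ℤ.*-identityʳ y) ⟨
  ψ (y ℤ.* 1ℤ)   ≡⟨ ψ-· y 1ℤ ⟩
  y ℤ.* ψ 1ℤ     ≡⟨ cong (y ℤ.*_) (eq []) ⟩
  y ℤ.* x        ≡⟨ ℤ.*-comm y x ⟩
  x ℤ.* y        ∎
functional-unique (suc n) ψ (x₀ , x₁) ψ-+ ψ-· eq (y₀ , y₁) = begin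
  ψ (y₀ , y₁)
    ≡⟨ cong ψ (cong₂ _,_ (+ᵛ-identityʳ y₀) (+ᵛ-identityˡ y₁)) ⟨
  ψ (y₀ +ᵛ 0ᵛ , 0ᵛ +ᵛ y₁)
    ≡⟨ ψ-+ (y₀ , 0ᵛ) (0ᵛ , y₁) ⟩
  ψ (y₀ , 0ᵛ) + ψ (0ᵛ , y₁)
    ≡⟨ cong₂ _+_
         (functional-unique n (λ y → ψ (y , 0ᵛ)) x₀
           (λ y z → trans (cong (λ w → ψ (y +ᵛ z , w)) (sym (+ᵛ-identityˡ 0ᵛ))) (ψ-+ (y , 0ᵛ) (z , 0ᵛ)))
           (λ c y → trans (cong (λ w → ψ (c · y , w)) (sym (·-zeroʳ c))) (ψ-· c (y , 0ᵛ)))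
           (λ v → eq (zero ∷ v)) y₀)
         (functional-unique n (λ y → ψ (0ᵛ , y)) x₁
           (λ y z → trans (cong (λ w → ψ (w , y +ᵛ z)) (sym (+ᵛ-identityˡ 0ᵛ))) (ψ-+ (0ᵛ , y) (0ᵛ , z)))
           (λ c y → trans (cong (λ w → ψ (w , c · y)) (sym (·-zeroʳ c))) (ψ-· c (0ᵛ , y)))
           (λ v → eq (suc zero ∷ v)) y₁) ⟩
  ⟨ x₀ ∣ y₀ ⟩ + ⟨ x₁ ∣ y₁ ⟩ ∎

sum-0 : ∀ {N} (g : Fin N → ℤ) → (∀ j → g j ≡ 0ℤ) → sum g ≡ 0ℤ
sum-0 {zero}  g eq = refl
sum-0 {suc N} g eq = cong₂ _+_ (eq zero) (sum-0 (g Fun.∘ suc) (eq Fun.∘ suc))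

sum-single : ∀ {N} (g : Fin N → ℤ) i → (∀ j → j ≢ i → g j ≡ 0ℤ) → sum g ≡ g i
sum-single g zero    eq =
  trans (cong (λ z → g zero + z) (sum-0 (g Fun.∘ suc) λ j → eq (suc j) λ ())) (ℤ.+-identityʳ _)
sum-single g (suc i) eq = trans
  (cong₂ _+_ (eq zero λ ()) (sum-single (g Fun.∘ suc) i λ j j≢i → eq (suc j) (j≢i Fun.∘ Fin.suc-injective)))
  (ℤ.+-identityˡ _)

module Ordered {n N : ℕ} (ordering : Fin N ↔ Vec (Fin 2) n) where

  open Inverse ordering using (to; from; strictlyInverseˡ; strictlyInverseʳ)

  to-injective : ∀ {i j} → to i ≡ to j → i ≡ j
  to-injective {i} {j} eq = trans (sym (strictlyInverseʳ i)) (trans (cong from eq) (strictlyInverseʳ j))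

  at-unit-to : ∀ i j → at (unit (to j)) (to i) ≡ indicator (does (i Fin.≟ j))
  at-unit-to i j = trans (at-unit (to i) (to j))
    (cong indicator (does-⇔ (mk⇔ to-injective (cong to)) (to i ≟ᵛ to j) (i Fin.≟ j)))

  ∑-at : ∀ x y → ∑[ j < N ] (at x (to j) ℤ.* at y (to j)) ≡ ⟨ x ∣ y ⟩
  ∑-at x = functional-unique n (λ y → ∑[ j < N ] (at x (to j) ℤ.* at y (to j))) x additive homogeneous units
    where
    additive : ∀ y z → _
    additive y z = trans
      (sum-cong-≗ λ j → trans (cong (at x (to j) ℤ.*_) (at-+ y z (to j))) (ℤ.*-distribˡ-+ (at x (to j)) _ _))
      (∑-distrib-+ (λ j → at x (to j) ℤ.* at y (to j)) (λ j → at x (to j) ℤ.* at z (to j)))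
    homogeneous : ∀ c y → _
    homogeneous c y = trans
      (sum-cong-≗ λ j → trans (cong (at x (to j) ℤ.*_) (at-· c y (to j))) (swap (at x (to j)) c (at y (to j))))
      (sym (*-distribˡ-sum c (λ j → at x (to j) ℤ.* at y (to j))))
      where
      swap : ∀ a b c → a ℤ.* (b ℤ.* c) ≡ b ℤ.* (a ℤ.* c)
      swap a b c = trans (sym (ℤ.*-assoc a b c)) (trans (cong (ℤ._* c) (ℤ.*-comm a b)) (ℤ.*-assoc b a c))
    units : ∀ v → ∑[ j < N ] (at x (to j) ℤ.* at (unit v) (to j)) ≡ at x v
    units v = begin
      ∑[ j < N ] (at x (to j) ℤ.* at (unit v) (to j))
        ≡⟨ sum-single _ (from v) (λ j j≢v → trans (cong (at x (to j) ℤ.*_) (off-diagonal j j≢v)) (ℤ.*-zeroʳ (at x (to j)))) ⟩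
      at x (to (from v)) ℤ.* at (unit v) (to (from v))
        ≡⟨ cong (λ w → at x w ℤ.* at (unit v) w) (strictlyInverseˡ v) ⟩
      at x v ℤ.* at (unit v) v
        ≡⟨ cong (at x v ℤ.*_) (trans (at-unit v v) (cong indicator (dec-true (v ≟ᵛ v) refl))) ⟩
      at x v ℤ.* 1ℤ
        ≡⟨ ℤ.*-identityʳ _ ⟩
      at x v ∎
      where
      off-diagonal : ∀ j → j ≢ from v → at (unit v) (to j) ≡ 0ℤ
      off-diagonal j j≢v = trans (at-unit (to j) v) (cong indicator (dec-false (to j ≟ᵛ v)
        λ eq → j≢v (trans (sym (strictlyInverseʳ j)) (cong from eq))))

  matrix : F n ⇒ F n → Matrix N N
  matrix f i j = at (f $ unit (to j)) (to i)

  matrix-∘ : ∀ f g → matrix f *ᴹ matrix g ≈ᴹ matrix (f ∘ g)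
  matrix-∘ f g i k = begin
    ∑[ j < N ] (at (f $ unit (to j)) (to i) ℤ.* at y (to j))
      ≡⟨ sum-cong-≗ (λ j → cong (ℤ._* at y (to j)) (transpose j)) ⟩
    ∑[ j < N ] (at (adj f (unit (to i))) (to j) ℤ.* at y (to j))
      ≡⟨ ∑-at (adj f (unit (to i))) y ⟩
    ⟨ adj f (unit (to i)) ∣ y ⟩
      ≡⟨ adjoint (f ᵀ) (unit (to i)) y ⟩
    ⟨ unit (to i) ∣ f $ y ⟩
      ≡⟨ ⟨⟩-comm (unit (to i)) (f $ y) ⟩
    ⟨ f $ y ∣ unit (to i) ⟩
      ≡⟨ ⟨∣unit⟩ (f $ y) (to i) ⟩
    at (f $ y) (to i) ∎
    where
    y = g $ unit (to k)
    transpose : ∀ j → at (f $ unit (to j)) (to i) ≡ at (adj f (unit (to i))) (to j)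
    transpose j = begin
      at (f $ unit (to j)) (to i)               ≡⟨ ⟨∣unit⟩ (f $ unit (to j)) (to i) ⟨
      ⟨ f $ unit (to j) ∣ unit (to i) ⟩         ≡⟨ adjoint f (unit (to j)) (unit (to i)) ⟩
      ⟨ unit (to j) ∣ adj f (unit (to i)) ⟩     ≡⟨ ⟨⟩-comm (unit (to j)) (adj f (unit (to i))) ⟩
      ⟨ adj f (unit (to i)) ∣ unit (to j) ⟩     ≡⟨ ⟨∣unit⟩ (adj f (unit (to i))) (to j) ⟩
      at (adj f (unit (to i))) (to j)           ∎

  matrix-cong : ∀ {f g} → f ≗ g → matrix f ≈ᴹ matrix g
  matrix-cong eq i j = cong (λ x → at x (to i)) (eq (unit (to j)))

  matrix-id : matrix idₗ ≈ᴹ identity N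
  matrix-id = at-unit-to

  unimodular : ∀ {f} → IsIso f → Unimodular (matrix f)
  unimodular {f} i = matrix (inv i) , product f (inv i) (inverseʳ i) , product (inv i) f (inverseˡ i)
    where
    product : ∀ f g → f ∘ g ≗ idₗ → matrix f *ᴹ matrix g ≈ᴹ identity N
    product f g eq j k = trans (matrix-∘ f g j k) (trans (matrix-cong {f ∘ g} {idₗ} eq j k) (matrix-id j k))

  ∼⇒equivalent : ∀ {f g X Y} → f ∼ g → X ≈ᴹ matrix f → matrix g ≈ᴹ Y → IntegrallyEquivalent X Y
  ∼⇒equivalent {f} {g} {X} {Y} e X≈f g≈Y =
    -- The square cod ∘ f = g ∘ dom is solved for g, hence the inverse on the right.
    matrix (cod e) , matrix (inv (domIso e)) ,
    unimodular (codIso e) , unimodular (isIso-inv (domIso e)) , λ i k → begin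
      ∑[ j < N ] (∑[ l < N ] (matrix (cod e) i l ℤ.* X l j) ℤ.* V j k)
        ≡⟨ sum-cong-≗ (λ j → cong (ℤ._* V j k) (trans
             (sum-cong-≗ λ l → cong (matrix (cod e) i l ℤ.*_) (X≈f l j)) (matrix-∘ (cod e) f i j))) ⟩
      ∑[ j < N ] (matrix (cod e ∘ f) i j ℤ.* V j k)
        ≡⟨ matrix-∘ (cod e ∘ f) (inv (domIso e)) i k ⟩
      matrix (cod e ∘ f ∘ inv (domIso e)) i k
        ≡⟨ matrix-cong {cod e ∘ f ∘ inv (domIso e)} {g}
             (λ x → trans (square e _) (cong (g $_) (inverseʳ (domIso e) x))) i k ⟩
      matrix g i k
        ≡⟨ g≈Y i k ⟩
      Y i k ∎
    where V = matrix (inv (domIso e))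

  matrix-diag : ∀ d → matrix (diag n d) ≈ᴹ diagonal (λ i → at d (to i))
  matrix-diag d i j = trans (at-diag d (unit (to j)) (to i))
    (trans (cong (at d (to i) ℤ.*_) (at-unit-to i j)) (scale-indicator (does (i Fin.≟ j))))
    where
    scale-indicator : ∀ b → at d (to i) ℤ.* indicator b ≡ (if b then at d (to i) else 0ℤ)
    scale-indicator true  = ℤ.*-identityʳ _
    scale-indicator false = ℤ.*-zeroʳ (at d (to i))

-- Entries of the adjacency matrix of the cube

differ-tail : ∀ {n} {u v : Vec (Fin 2) n} a →
  DifferInExactlyOne (a ∷ u) (a ∷ v) → DifferInExactlyOne u v
differ-tail a (zero  , a≢a , _)        = contradiction refl a≢a
differ-tail a (suc i , u≢v , unique) = i , u≢v , λ d → Fin.suc-injective (unique {suc _} d)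

differ-cons : ∀ {n} {u v : Vec (Fin 2) n} a →
  DifferInExactlyOne u v → DifferInExactlyOne (a ∷ u) (a ∷ v)
differ-cons {u = u} {v} a (i , u≢v , unique) = suc i , u≢v , λ {j} → unique′ j
  where
  unique′ : ∀ j → DifferAt (a ∷ u) (a ∷ v) j → suc i ≡ j
  unique′ zero    a≢a = contradiction refl a≢a
  unique′ (suc j) d   = cong suc (unique d)

differ-head⇒≡ : ∀ {n} {u v : Vec (Fin 2) n} {a b} → a ≢ b →
  DifferInExactlyOne (a ∷ u) (b ∷ v) → u ≡ v
differ-head⇒≡ {u = u} {v} a≢b (i , _ , unique) = lookup-injective u v λ j →
  decidable-stable (lookup u j Fin.≟ lookup v j) λ d →
    contradiction (trans (sym (unique {zero} a≢b)) (unique {suc j} d)) λ ()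
  where
  lookup-injective : ∀ {n} (u v : Vec (Fin 2) n) → (∀ j → lookup u j ≡ lookup v j) → u ≡ v
  lookup-injective []      []      eq = refl
  lookup-injective (a ∷ u) (b ∷ v) eq = cong₂ _∷_ (eq zero) (lookup-injective u v (eq Fun.∘ suc))

≡⇒differ-head : ∀ {n} {u v : Vec (Fin 2) n} {a b} → a ≢ b → u ≡ v →
  DifferInExactlyOne (a ∷ u) (b ∷ v)
≡⇒differ-head {u = u} {a = a} {b} a≢b refl = zero , a≢b , λ {j} → unique j
  where
  unique : ∀ j → DifferAt (a ∷ u) (b ∷ u) j → zero ≡ j
  unique zero    _   = refl
  unique (suc j) u≢u = contradiction refl u≢u

at-adjacency : ∀ {n} (u v : Vec (Fin 2) n) →
  indicator (does (differInExactlyOne? u v)) ≡ at (adjacency n $ unit v) u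
at-adjacency []      []      = refl
at-adjacency (a ∷ u) (b ∷ v) = entry a b
  where
  same : ∀ a → indicator (does (differInExactlyOne? (a ∷ u) (a ∷ v))) ≡ at (adjacency _ $ unit v) u
  same a = trans
    (cong indicator (does-⇔ (mk⇔ (differ-tail a) (differ-cons a))
      (differInExactlyOne? (a ∷ u) (a ∷ v)) (differInExactlyOne? u v)))
    (at-adjacency u v)
  different : ∀ {a b} → a ≢ b → indicator (does (differInExactlyOne? (a ∷ u) (b ∷ v))) ≡ at (unit v) u
  different {a} {b} a≢b = trans
    (cong indicator (does-⇔ (mk⇔ (differ-head⇒≡ a≢b) (≡⇒differ-head a≢b))
      (differInExactlyOne? (a ∷ u) (b ∷ v)) (u ≟ᵛ v)))
    (sym (at-unit u v))
  Adj = adjacency _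
  entry : ∀ a b → indicator (does (differInExactlyOne? (a ∷ u) (b ∷ v))) ≡ at (adjacency _ $ unit (b ∷ v)) (a ∷ u)
  entry zero zero = trans (same zero)
    (cong (λ x → at x u) (sym (+ᵛ-identityʳ (Adj $ unit v))))
  entry zero (suc zero) = trans (different λ ())
    (cong (λ x → at x u) (sym (trans (cong (_+ᵛ unit v) ($-0 Adj)) (+ᵛ-identityˡ (unit v)))))
  entry (suc zero) zero = trans (different λ ())
    (cong (λ x → at x u) (sym (trans (cong (unit v +ᵛ_) ($-0 Adj)) (+ᵛ-identityʳ (unit v)))))
  entry (suc zero) (suc zero) = trans (same (suc zero))
    (cong (λ x → at x u) (sym (+ᵛ-identityˡ (Adj $ unit v))))

-- Counting vertices by weight

weight : ∀ {n} → Vec (Fin 2) n → ℕ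
weight []             = 0
weight (zero ∷ v)     = weight v
weight (suc zero ∷ v) = suc (weight v)

weight≤ : ∀ {n} (v : Vec (Fin 2) n) → weight v ≤ n
weight≤ []             = z≤n
weight≤ (zero ∷ v)     = ℕ.m≤n⇒m≤1+n (weight≤ v)
weight≤ (suc zero ∷ v) = s≤s (weight≤ v)

at-level : ∀ {n} φ (v : Vec (Fin 2) n) → at (level n φ) v ≡ φ (weight v)
at-level φ []             = refl
at-level φ (zero ∷ v)     = at-level φ v
at-level φ (suc zero ∷ v) = at-level (φ Fun.∘ suc) v

-- The sum of φ |S| over all subsets S, in the form of Pascal's recursion.
total : ℕ → (ℕ → ℤ) → ℤ
total zero    φ = φ 0
total (suc n) φ = total n φ + total n (φ Fun.∘ suc)

total-cong : ∀ n {φ ψ} → (∀ l → φ l ≡ ψ l) → total n φ ≡ total n ψ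
total-cong zero    eq = eq 0
total-cong (suc n) eq = cong₂ _+_ (total-cong n eq) (total-cong n (eq Fun.∘ suc))

total-+ : ∀ n φ ψ → total n (λ l → φ l + ψ l) ≡ total n φ + total n ψ
total-+ zero    φ ψ = refl
total-+ (suc n) φ ψ = trans (cong₂ _+_ (total-+ n φ ψ) (total-+ n (φ Fun.∘ suc) (ψ Fun.∘ suc)))
  (+ᵛ-interchange {𝟙} (total n φ) (total n ψ) _ _)

total-0 : ∀ n → total n (λ _ → 0ℤ) ≡ 0ℤ
total-0 zero    = refl
total-0 (suc n) = cong₂ _+_ (total-0 n) (total-0 n)

total-indicator : ∀ n w → total n (λ l → indicator (l ≡ᵇ w)) ≡ + (n C w)
total-indicator zero    zero    = refl
total-indicator zero    (suc w) = cong (+_) (sym (k>n⇒nCk≡0 {0} {suc w} (s≤s z≤n)))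
total-indicator (suc n) zero    = cong₂ _+_ (total-indicator n 0) (total-0 n)
total-indicator (suc n) (suc w) = begin
  total n (λ l → indicator (l ≡ᵇ suc w)) + total n (λ l → indicator (l ≡ᵇ w))
    ≡⟨ cong₂ _+_ (total-indicator n (suc w)) (total-indicator n w) ⟩
  + (n C suc w ℕ.+ n C w)
    ≡⟨ cong (+_) (trans (ℕ.+-comm (n C suc w) (n C w)) (nCk+nC[k+1]≡[n+1]C[k+1] n w)) ⟩
  + (suc n C suc w) ∎

⟨1∣level⟩ : ∀ n φ → ⟨ level n (λ _ → 1ℤ) ∣ level n φ ⟩ ≡ total n φ
⟨1∣level⟩ zero    φ = ℤ.*-identityˡ (φ 0)
⟨1∣level⟩ (suc n) φ = cong₂ _+_ (⟨1∣level⟩ n φ) (⟨1∣level⟩ n (φ Fun.∘ suc))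

multiplicity-sum : ∀ {N} z (d : Fin N → ℤ) → + multiplicity z d ≡ ∑[ i < N ] indicator (does (d i ℤ.≟ z))
multiplicity-sum {zero}  z d = refl
multiplicity-sum {suc N} z d with does (d zero ℤ.≟ z)
... | true  = cong (λ x → 1ℤ + x) (multiplicity-sum z (d Fun.∘ suc))
... | false = trans (multiplicity-sum z (d Fun.∘ suc)) (sym (ℤ.+-identityˡ _))

module _ {n N : ℕ} (ordering : Fin N ↔ Vec (Fin 2) n) where

  open Inverse ordering using (to)
  open Ordered ordering

  -- Written as a pairing with the all-ones function, the sum loses its ordering by `∑-at`.
  sum-weight : ∀ φ → ∑[ i < N ] φ (weight (to i)) ≡ total n φ
  sum-weight φ = begin
    ∑[ i < N ] φ (weight (to i))
      ≡⟨ sum-cong-≗ (λ i → trans (sym (ℤ.*-identityˡ _))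
           (sym (cong₂ ℤ._*_ (at-level (λ _ → 1ℤ) (to i)) (at-level φ (to i))))) ⟩
    ∑[ i < N ] (at (level n λ _ → 1ℤ) (to i) ℤ.* at (level n φ) (to i))
      ≡⟨ ∑-at (level n λ _ → 1ℤ) (level n φ) ⟩
    ⟨ level n (λ _ → 1ℤ) ∣ level n φ ⟩
      ≡⟨ ⟨1∣level⟩ n φ ⟩
    total n φ ∎

  multiplicity-weight : ∀ k (f : ℕ → ℕ) →
    + multiplicity (+ k) (λ i → + f (weight (to i))) ≡ total n (λ l → indicator (f l ≡ᵇ k))
  multiplicity-weight k f = trans
    (multiplicity-sum (+ k) (λ i → + f (weight (to i))))
    (sum-weight (λ l → indicator (f l ≡ᵇ k)))

distance-0 : ∀ m l → (∣ m - l ∣ ≡ᵇ 0) ≡ (l ≡ᵇ m)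
distance-0 zero    zero    = refl
distance-0 zero    (suc l) = refl
distance-0 (suc m) zero    = refl
distance-0 (suc m) (suc l) = distance-0 m l

-- The degrees on either side of m at a positive distance are distinct, so the indicators add; this
-- is the origin of the factor 2.
distance-suc : ∀ m l k → indicator (∣ m - l ∣ ≡ᵇ suc k)
                       ≡ indicator (m ≡ᵇ l ℕ.+ suc k) + indicator (l ≡ᵇ m ℕ.+ suc k)
distance-suc zero    zero    k = refl
distance-suc zero    (suc l) k = sym (ℤ.+-identityˡ _)
distance-suc (suc m) zero    k = sym (ℤ.+-identityʳ _)
distance-suc (suc m) (suc l) k = distance-suc m l k

≡ᵇ-∸ : ∀ m l k → k ≤ m → (m ≡ᵇ l ℕ.+ k) ≡ (l ≡ᵇ m ∸ k)
≡ᵇ-∸ m l k k≤m = does-⇔ (mk⇔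
  (λ eq → trans (sym (ℕ.m+n∸n≡m l k)) (cong (_∸ k) (sym eq)))
  (λ eq → trans (sym (ℕ.m∸n+n≡m k≤m)) (cong (ℕ._+ k) (sym eq))))
  (m ℕ.≟ l ℕ.+ k) (l ℕ.≟ m ∸ k)

central-symmetry : ∀ m k → k ≤ m → (m ℕ.+ m) C (m ℕ.+ k) ≡ (m ℕ.+ m) C (m ∸ k)
central-symmetry m k k≤m = trans (nCk≡nC[n∸k] (ℕ.+-monoʳ-≤ m k≤m))
  (cong ((m ℕ.+ m) C_) (ℕ.[m+n]∸[m+o]≡n∸o m m k))

distance≤ : ∀ m l → l ≤ m ℕ.+ m → ∣ m - l ∣ ≤ m
distance≤ m l l≤2m with ℕ.≤-total m l
... | inj₁ m≤l = subst (_≤ m) (sym (ℕ.m≤n⇒∣m-n∣≡n∸m m≤l)) (ℕ.m≤n+o⇒m∸n≤o l m l≤2m)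
... | inj₂ l≤m = subst (_≤ m) (sym (ℕ.m≤n⇒∣n-m∣≡n∸m l≤m)) (ℕ.m∸n≤m m l)

equivalent-diagonal : ∀ m → (ordering : Fin (2 ^ (m ℕ.+ m)) ↔ Vec (Fin 2) (m ℕ.+ m)) →
  ∃[ d ] (IntegrallyEquivalent (adjacencyMatrix (cube (m ℕ.+ m)) ordering) (diagonal d)
        × multiplicity 0ℤ d ≡ (m ℕ.+ m) C m
        × (∀ i → d i ≢ 0ℤ → ∃[ k ] (1 ≤ k × k ≤ m × d i ≡ + k))
        × (∀ k → 1 ≤ k → k ≤ m → multiplicity (+ k) d ≡ 2 * ((m ℕ.+ m) C (m ∸ k))))
equivalent-diagonal m ordering = d , equivalent , zeros , range , nonzeros
  where
  open Inverse ordering using (to)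
  open Ordered ordering
  n = m ℕ.+ m
  d : Fin (2 ^ n) → ℤ
  -- Half the absolute value of the eigenvalue n - 2 w attached to weight w.
  d i = + ∣ m - weight (to i) ∣
  equivalent : IntegrallyEquivalent (adjacencyMatrix (cube n) ordering) (diagonal d)
  equivalent = ∼⇒equivalent (adjacency-∼-diag m) (λ i j → at-adjacency (to i) (to j))
    λ i j → trans (matrix-diag _ i j)
      (cong (λ x → if does (i Fin.≟ j) then x else 0ℤ) (at-level (λ l → + ∣ m - l ∣) (to i)))
  zeros : multiplicity 0ℤ d ≡ n C m
  zeros = ℤ.+-injective (begin
    + multiplicity 0ℤ d                          ≡⟨ multiplicity-weight ordering 0 (∣ m -_∣) ⟩
    total n (λ l → indicator (∣ m - l ∣ ≡ᵇ 0))   ≡⟨ total-cong n (λ l → cong indicator (distance-0 m l)) ⟩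
    total n (λ l → indicator (l ≡ᵇ m))           ≡⟨ total-indicator n m ⟩
    + (n C m)                                    ∎)
  range : ∀ i → d i ≢ 0ℤ → ∃[ k ] (1 ≤ k × k ≤ m × d i ≡ + k)
  range i d≢0 = ∣ m - weight (to i) ∣ ,
    ℕ.n≢0⇒n>0 (λ eq → d≢0 (cong (+_) eq)) , distance≤ m _ (weight≤ (to i)) , refl
  nonzeros : ∀ k → 1 ≤ k → k ≤ m → multiplicity (+ k) d ≡ 2 * (n C (m ∸ k))
  nonzeros (suc k) _ k≤m = ℤ.+-injective (begin
    + multiplicity (+ suc k) d
      ≡⟨ multiplicity-weight ordering (suc k) (∣ m -_∣) ⟩
    total n (λ l → indicator (∣ m - l ∣ ≡ᵇ suc k))
      ≡⟨ total-cong n (λ l → trans (distance-suc m l k)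
           (cong (λ b → indicator b + indicator (l ≡ᵇ m ℕ.+ suc k)) (≡ᵇ-∸ m l (suc k) k≤m))) ⟩
    total n (λ l → indicator (l ≡ᵇ m ∸ suc k) + indicator (l ≡ᵇ m ℕ.+ suc k))
      ≡⟨ total-+ n _ _ ⟩
    total n (λ l → indicator (l ≡ᵇ m ∸ suc k)) + total n (λ l → indicator (l ≡ᵇ m ℕ.+ suc k))
      ≡⟨ cong₂ _+_ (total-indicator n (m ∸ suc k)) (total-indicator n (m ℕ.+ suc k)) ⟩
    + (n C (m ∸ suc k) ℕ.+ n C (m ℕ.+ suc k))
      ≡⟨ cong (λ c → + (n C (m ∸ suc k) ℕ.+ c)) (trans (central-symmetry m (suc k) k≤m) (sym (ℕ.+-identityʳ _))) ⟩
    + (2 * (n C (m ∸ suc k))) ∎)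

theorem1p1 : ∀ (m n : ℕ) → 1 ≤ m → n ≡ 2 * m →
    (ordering : Fin (2 ^ n) ↔ Vec (Fin 2) n) →
    ∃[ d ] (IntegrallyEquivalent (adjacencyMatrix (cube n) ordering) (diagonal d)
    × multiplicity 0ℤ d ≡ n C m
    × (∀ i → d i ≢ 0ℤ → ∃[ k ] (1 ≤ k × k ≤ m × d i ≡ + k))
    × (∀ k → 1 ≤ k → k ≤ m → multiplicity (+ k) d ≡ 2 * (n C (m ∸ k))))
theorem1p1 m n _ n≡2m ordering with trans n≡2m (cong (m ℕ.+_) (ℕ.+-identityʳ m))
... | refl = equivalent-diagonal m ordering
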